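{- Let $p$ be a prime with $p\equiv 3\pmod 4$. Then $$\sum_{k=0}^{p-1}\frac{\binom{2k}k^2}{8^k}\equiv-\sum_{k=0}^{p-1}\frac{\binom{2k}k^2}{(-16)^k}\pmod{p^3}.$$
   Context: Congruences between rational numbers whose denominators are prime to $p$ are understood in the ring of $p$-integral rationals: $a\equiv b\pmod{p^m}$ means $(a-b)/p^m$ is a rational number with denominator prime to $p$. -}

module Defs where

open import Data.Nat as ℕ using (ℕ; zero; suc; _^_; _%_)
open import Data.Nat.Divisibility using (_∣_)
open import Data.Nat.Properties using (m^n≢0)
open import Data.Nat.Combinatorics using (_C_)
open import Data.Integer as ℤ using (ℤ; +_; -[1+_])
open import Data.Rational as ℚ using (ℚ; ↥_; ↧ₙ_; _/_; _-_)
open import Data.Product using (_×_)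
open import Relation.Nullary using (¬_)

sumℚ : ℕ → (ℕ → ℚ) → ℚ
sumℚ zero    f = ℚ.0ℚ
sumℚ (suc n) f = sumℚ n f ℚ.+ f n

term8 : ℕ → ℚ
term8 k = (+ (((2 ℕ.* k) C k) ^ 2)) / (8 ^ k)
  where instance _ = m^n≢0 8 k

-- binom(2k,k)^2 / (-16)^k  =  (-1)^k binom(2k,k)^2 / 16^k
term-16 : ℕ → ℚ
term-16 k = ((ℤ.- ℤ.1ℤ) ℤ.^ k ℤ.* (+ (((2 ℕ.* k) C k) ^ 2))) / (16 ^ k)
  where instance _ = m^n≢0 16 k

-- Congruence in the p-integral rationals: a ≡ b (mod p^m) iff (a - b)/p^m
-- has denominator prime to p. With (a-b) = N/D in lowest terms, this says
-- p^m ∣ N and p ∤ D.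
_≡_[mod_^_] : ℚ → ℚ → ℕ → ℕ → Set
a ≡ b [mod p ^ m ] = ((p ^ m) ∣ ℤ.∣ ↥ (a - b) ∣) × ¬ (p ∣ ↧ₙ (a - b))

{-# OPTIONS --safe #-}

-- With p = 2n + 1, let T(x) = Σₖ (-1)ᵏ C(n,k) C(n+k,k) xᵏ, a Legendre polynomial satisfying T(1 - x) = -T(x)
-- because n is odd, and let F(x) = Σ_{k<p} C(2k,k)²/16ᵏ xᵏ, so that the claim is F(2) + F(-1) ≡ 0 (mod p³).
-- The recurrences of the two coefficient sequences give F = T + p²G with G p-integral, so only
-- G(2) + G(-1) ≡ 0 (mod p) is left.  G solves an inhomogeneous form of the differential equation of T;
-- integrating it against T over [0,-1] + [0,2] - [0,1] expresses T′(-1) (G(2) + G(-1)) through ∫ T² and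
-- ∫ x^(p-1) T.  The first vanishes by antisymmetry.  Modulo p the second is the Fermat quotient (2ᵖ - 2)/p plus
-- Σₖ C(n,k)² (2·2ᵏ - (-1)ᵏ - 1)/k, and each of these sums is evaluated in terms of harmonic numbers and
-- Σₖ (-1)ᵏ C(n,k)/k over k ≤ n/2, where everything cancels.  Finally T′(-1) is a unit modulo p.
module Submission where

open import Defs
open import Algebra.Bundles using (CommutativeRing)
open import Data.Integer as ℤ using (-[1+_])
import Data.Integer.Properties as ℤₚ
open import Data.Nat as ℕ using (ℕ; zero; suc; _%_; z≤n; s≤s)
open import Data.Nat.Combinatorics using (_C_; nCk+nC[k+1]≡[n+1]C[k+1]; nCn≡1)
open import Data.Nat.Combinatorics.Specification using (k>n⇒nCk≡0)
open import Data.Nat.Coprimality as Coprimality using (Coprime; coprime-divisor)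
open import Data.Nat.Divisibility
  using (_∣_; _∤_; divides; >⇒∤; ∣-refl; ∣-trans; ∣m+n∣m⇒∣n; m∣m*n; n∣m*n; ∣m⇒∣m*n; *-monoʳ-∣; *-cancelˡ-∣)
open import Data.Nat.DivMod using (m≡m%n+[m/n]*n)
open import Data.Nat.Primality using (Prime; euclidsLemma; prime⇒nonTrivial; prime⇒nonZero)
import Data.Nat.Properties as ℕₚ
open import Data.Product using (_×_; _,_)
open import Data.Rational
open import Data.Rational.Properties
open import Data.Rational.Solver using (module +-*-Solver)
open import Data.Rational.Unnormalised as ℚᵘ using (mkℚᵘ; *≡*)
import Data.Rational.Unnormalised.Properties as ℚᵘₚ
open import Data.Sum using (_⊎_; inj₁; inj₂; [_,_]′)
open import Function using (_∘_)
open import Relation.Binary.Definitions using (tri<; tri≈; tri>)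
open import Relation.Binary.PropositionalEquality
open import Relation.Nullary using (¬_; contradiction)

open import Algebra.Properties.Semiring.Exp (CommutativeRing.semiring +-*-commutativeRing)
  using (^-homo-*) renaming (_^_ to _^^_)
open +-*-Solver
open ≡-Reasoning

-- The path of integration is forced. The factor x(1 - x) in the Legendre operator vanishes at 0 and
-- 1, so only -1 and 2 leave boundary terms. These two points are exchanged by x ↦ 1 - x, whence
-- T′(2) = T′(-1), and so G(2) and G(-1) enter with the same weight. The multiple -1 of [0,1] is the
-- only one for which ∫ f(1 - x) = -∫ f(x). It also turns ∫ x^(p-1) into (2ᵖ - 2)/p, which is
-- p-integral although the index brings a denominator p. Boundary terms containing T(-1) would spoil
-- the identity; they drop out because T(-1) ≡ Σₖ (-1)ᵏ C(n,k)² = 0, again since n is odd. Integrals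
-- are handled algebraically: an integral is the sequence of its values on xᵐ, and its value on (1 -
-- x)ᵃ xᵐ is an iterated difference of that sequence.

-- Natural numbers inside ℚ, linear combinations of equations, finite sums.

ι : ℕ → ℚ
ι zero    = 0ℚ
ι (suc n) = 1ℚ + ι n

infix 10 #_
#_ : ∀ {m} → ℕ → Polynomial m
# n = con (ι n)

infixr 9 1+_
-- `ι (suc n)` reduces to `1ℚ + ι n`, so successors written this way match the goals by computation.
1+_ : ∀ {m} → Polynomial m → Polynomial m
1+ x = # 1 :+ x

-1ℚ 2ℚ : ℚ
-1ℚ = - 1ℚ
2ℚ = ι 2

-- Proof by linear combination: once the multiplier `c` of the known equation is chosen, the last
-- argument is a polynomial identity for the ring solver. `linear₂` and `linear₃` combine several
-- equations.
linear₁ : ∀ {l r a b} c → a ≡ b → l - r ≡ c * (a - b) → l ≡ r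
linear₁ {l} {r} {a} c refl e = begin
  l                       ≡⟨ solve 2 (λ l r → l := (l :- r) :+ r) refl l r ⟩
  (l - r) + r             ≡⟨ cong (_+ r) e ⟩
  c * (a - a) + r         ≡⟨ solve 3 (λ c a r → c :* (a :- a) :+ r := r) refl c a r ⟩
  r                       ∎

linear₂ : ∀ {l r a b a′ b′} c c′ → a ≡ b → a′ ≡ b′ →
          l - r ≡ c * (a - b) + c′ * (a′ - b′) → l ≡ r
linear₂ {l} {r} {a} {a′ = a′} c c′ refl refl e = linear₁ {l} {r} {a} c refl (begin
  l - r                           ≡⟨ e ⟩
  c * (a - a) + c′ * (a′ - a′)    ≡⟨ solve 4 (λ c a c′ a′ → c :* (a :- a) :+ c′ :* (a′ :- a′) := c :* (a :- a)) refl
      c a c′ a′ ⟩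
  c * (a - a)                     ∎)

ι-+ : ∀ m n → ι (m ℕ.+ n) ≡ ι m + ι n
ι-+ zero    n = sym (+-identityˡ (ι n))
ι-+ (suc m) n = trans (cong (1ℚ +_) (ι-+ m n)) (sym (+-assoc 1ℚ (ι m) (ι n)))

ι-* : ∀ m n → ι (m ℕ.* n) ≡ ι m * ι n
ι-* zero    n = sym (*-zeroˡ (ι n))
ι-* (suc m) n = begin
  ι (n ℕ.+ m ℕ.* n)   ≡⟨ ι-+ n (m ℕ.* n) ⟩
  ι n + ι (m ℕ.* n)   ≡⟨ cong (ι n +_) (ι-* m n) ⟩
  ι n + ι m * ι n     ≡⟨ solve 2 (λ m n → n :+ m :* n := (1+ m) :* n) refl (ι m) (ι n) ⟩
  (1ℚ + ι m) * ι n    ∎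

0≤ι : ∀ n → 0ℚ ≤ ι n
0≤ι zero    = ≤-refl
0≤ι (suc n) = +-mono-≤ {0ℚ} {1ℚ} (nonNegative⁻¹ 1ℚ) (0≤ι n)

0<ι-suc : ∀ n → 0ℚ < ι (suc n)
0<ι-suc n = +-mono-<-≤ {0ℚ} {1ℚ} (positive⁻¹ 1ℚ) (0≤ι n)

ι-suc≢0 : ∀ n → NonZero (ι (suc n))
ι-suc≢0 n = pos⇒nonZero (ι (suc n)) {{positive (0<ι-suc n)}}

-- Indexing by the predecessor makes the reciprocal total.
1/suc : ℕ → ℚ
1/suc n = (1/ ι (suc n)) {{ι-suc≢0 n}}

*-1/suc : ∀ n → ι (suc n) * 1/suc n ≡ 1ℚ
*-1/suc n = *-inverseʳ (ι (suc n)) {{ι-suc≢0 n}}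

*-cancel-suc : ∀ n {x y} → ι (suc n) * x ≡ ι (suc n) * y → x ≡ y
*-cancel-suc n {x} {y} = *-cancelˡ-ι
  where
  *-cancelˡ-ι : ι (suc n) * x ≡ ι (suc n) * y → x ≡ y
  *-cancelˡ-ι e = begin
    x                          ≡⟨ unit x ⟨
    1/suc n * (ι (suc n) * x)  ≡⟨ cong (1/suc n *_) e ⟩
    1/suc n * (ι (suc n) * y)  ≡⟨ unit y ⟩
    y                          ∎
    where
    unit : ∀ z → 1/suc n * (ι (suc n) * z) ≡ z
    unit z = linear₁ z (*-1/suc n) (solve 3 (λ i j z → i :* (j :* z) :- z := z :* (j :* i :- # 1)) refl (1/suc n)
        (ι (suc n)) z)

sum-cong : ∀ N {f g : ℕ → ℚ} → (∀ k → k ℕ.< N → f k ≡ g k) → sumℚ N f ≡ sumℚ N g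
sum-cong zero    h = refl
sum-cong (suc N) h = cong₂ _+_ (sum-cong N (λ k k<N → h k (ℕₚ.m<n⇒m<1+n k<N))) (h N ℕₚ.≤-refl)

sum-ext : ∀ N {f g : ℕ → ℚ} → (∀ k → f k ≡ g k) → sumℚ N f ≡ sumℚ N g
sum-ext N h = sum-cong N (λ k _ → h k)

sum-0 : ∀ N → sumℚ N (λ _ → 0ℚ) ≡ 0ℚ
sum-0 zero    = refl
sum-0 (suc N) = trans (+-identityʳ _) (sum-0 N)

sum-+ : ∀ N f g → sumℚ N (λ k → f k + g k) ≡ sumℚ N f + sumℚ N g
sum-+ zero    f g = refl
sum-+ (suc N) f g = trans (cong (_+ (f N + g N)) (sum-+ N f g))
  (solve 4 (λ a b c d → (a :+ b) :+ (c :+ d) := (a :+ c) :+ (b :+ d)) refl (sumℚ N f) (sumℚ N g) (f N) (g N))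

sum-* : ∀ c N f → sumℚ N (λ k → c * f k) ≡ c * sumℚ N f
sum-* c zero    f = sym (*-zeroʳ c)
sum-* c (suc N) f = trans (cong (_+ c * f N) (sum-* c N f)) (sym (*-distribˡ-+ c (sumℚ N f) (f N)))

sum-linear : ∀ c d N f g → sumℚ N (λ k → c * f k + d * g k) ≡ c * sumℚ N f + d * sumℚ N g
sum-linear c d N f g = trans (sum-+ N (λ k → c * f k) (λ k → d * g k)) (cong₂ _+_ (sum-* c N f) (sum-* d N g))

sum-head : ∀ N f → sumℚ (suc N) f ≡ f 0 + sumℚ N (f ∘ suc)
sum-head zero    f = +-comm 0ℚ (f 0)
sum-head (suc N) f = trans (cong (_+ f (suc N)) (sum-head N f)) (+-assoc (f 0) (sumℚ N (f ∘ suc)) (f (suc N)))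

sum-telescope : ∀ N (f : ℕ → ℚ) → sumℚ N (λ k → f (suc k) - f k) ≡ f N - f 0
sum-telescope zero    f = sym (+-inverseʳ (f 0))
sum-telescope (suc N) f = trans (cong (_+ (f (suc N) - f N)) (sum-telescope N f))
  (solve 3 (λ a b c → (b :- a) :+ (c :- b) := c :- a) refl (f 0) (f N) (f (suc N)))

sum-swap : ∀ M N (f : ℕ → ℕ → ℚ) → sumℚ M (λ i → sumℚ N (f i)) ≡ sumℚ N (λ j → sumℚ M (λ i → f i j))
sum-swap zero    N f = sym (sum-0 N)
sum-swap (suc M) N f = trans (cong (_+ sumℚ N (f M)) (sum-swap M N f))
    (sym (sum-+ N (λ j → sumℚ M (λ i → f i j)) (f M)))

-- Binomial coefficients and the sums Σₖ C(m,k) C(n,k) xᵏ.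

bin : ℕ → ℕ → ℚ
bin n k = ι (n C k)

bin-0 : ∀ n → bin n 0 ≡ 1ℚ
bin-0 zero    = refl
bin-0 (suc n) = refl

bin-pascal : ∀ n k → bin (suc n) (suc k) ≡ bin n k + bin n (suc k)
bin-pascal n k = trans (cong ι (sym (nCk+nC[k+1]≡[n+1]C[k+1] n k))) (ι-+ (n C k) (n C suc k))

bin-absorb : ∀ n k → ι (suc k) * bin (suc n) (suc k) ≡ ι (suc n) * bin n k
bin-absorb n zero = begin
  ι 1 * bin (suc n) 1 ≡⟨ *-identityˡ (bin (suc n) 1) ⟩
  bin (suc n) 1       ≡⟨ go n ⟩
  ι (suc n)           ≡⟨ *-identityʳ (ι (suc n)) ⟨
  ι (suc n) * 1ℚ      ≡⟨ cong (ι (suc n) *_) (sym (bin-0 n)) ⟩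
  ι (suc n) * bin n 0 ∎
  where
  go : ∀ n → bin (suc n) 1 ≡ ι (suc n)
  go zero    = refl
  go (suc n) = trans (bin-pascal (suc n) 0) (cong₂ _+_ (bin-0 (suc n)) (go n))
bin-absorb zero (suc k) = trans (cong (ι (suc (suc k)) *_) (cong ι (k>n⇒nCk≡0 {1} {suc (suc k)} (s≤s (s≤s z≤n)))))
  (trans (*-zeroʳ (ι (suc (suc k)))) (sym (trans (cong (ι 1 *_) (cong ι (k>n⇒nCk≡0 {0} {suc k} (s≤s z≤n))))
      (*-zeroʳ (ι 1)))))
bin-absorb (suc n) (suc k) = begin
  ι (suc (suc k)) * bin (suc (suc n)) (suc (suc k))
    ≡⟨ cong (ι (suc (suc k)) *_) (bin-pascal (suc n) (suc k)) ⟩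
  ι (suc (suc k)) * (bin (suc n) (suc k) + bin (suc n) (suc (suc k)))
    ≡⟨ linear₂ 1ℚ 1ℚ (bin-absorb n k) (bin-absorb n (suc k))
         (solve 6 (λ n k a b c d →
            (1+ 1+ k) :* (a :+ b) :- ((1+ n) :* (c :+ d) :+ a) :=
            # 1 :* ((1+ k) :* a :- (1+ n) :* c) :+ # 1 :* ((1+ 1+ k) :* b :- (1+ n) :* d))
          refl (ι n) (ι k) (bin (suc n) (suc k)) (bin (suc n) (suc (suc k))) (bin n k) (bin n (suc k))) ⟩
  ι (suc n) * (bin n k + bin n (suc k)) + bin (suc n) (suc k)
    ≡⟨ cong (λ x → ι (suc n) * x + bin (suc n) (suc k)) (bin-pascal n k) ⟨
  ι (suc n) * bin (suc n) (suc k) + bin (suc n) (suc k)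
    ≡⟨ solve 2 (λ n a → (1+ n) :* a :+ a := (1+ 1+ n) :* a) refl (ι n) (bin (suc n) (suc k)) ⟩
  ι (suc (suc n)) * bin (suc n) (suc k) ∎

linear₃ : ∀ {l r a b a′ b′ a″ b″} c c′ c″ → a ≡ b → a′ ≡ b′ → a″ ≡ b″ →
          l - r ≡ c * (a - b) + c′ * (a′ - b′) + c″ * (a″ - b″) → l ≡ r
linear₃ {l} {r} {a} {a′ = a′} {a″ = a″} c c′ c″ refl refl refl e = linear₁ {l} {r} {a} c refl (trans e
  (solve 6 (λ c a c′ a′ c″ a″ → c :* (a :- a) :+ c′ :* (a′ :- a′) :+ c″ :* (a″ :- a″) := c :* (a :- a))
    refl c a c′ a′ c″ a″))

bin-vanish : ∀ {n k} → n ℕ.< k → bin n k ≡ 0ℚ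
bin-vanish n<k = cong ι (k>n⇒nCk≡0 n<k)

bin-ratio : ∀ n k → ι (suc k) * bin n (suc k) ≡ (ι n - ι k) * bin n k
bin-ratio n k = linear₂ 1ℚ (- ι (suc k)) (bin-absorb n k) (bin-pascal n k)
  (solve 5 (λ n k a b c → (1+ k) :* b :- (n :- k) :* a :=
      # 1 :* ((1+ k) :* c :- (1+ n) :* a) :+ (:- (1+ k)) :* (c :- (a :+ b)))
    refl (ι n) (ι k) (bin n k) (bin n (suc k)) (bin (suc n) (suc k)))

bin-lower : ∀ m k → (ι (suc m) - ι k) * bin (suc m) k ≡ ι (suc m) * bin m k
bin-lower m zero    = trans (cong ((ι (suc m) - 0ℚ) *_) (trans (bin-0 (suc m)) (sym (bin-0 m))))
  (solve 2 (λ m b → (m :- # 0) :* b := m :* b) refl (ι (suc m)) (bin m 0))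
bin-lower m (suc k) = linear₂ -1ℚ (ι (suc m)) (bin-absorb m k) (bin-pascal m k)
  (solve 5 (λ m k a b c → ((1+ m) :- (1+ k)) :* c :- (1+ m) :* b :=
      (:- # 1) :* ((1+ k) :* c :- (1+ m) :* a) :+ (1+ m) :* (c :- (a :+ b)))
    refl (ι m) (ι k) (bin m k) (bin m (suc k)) (bin (suc m) (suc k)))

binw : ℚ → ℕ → ℕ → ℚ
binw x n k = bin n k * x ^^ k

binw-ratio : ∀ x n k → ι (suc k) * binw x n (suc k) ≡ x * ((ι n - ι k) * binw x n k)
binw-ratio x n k = linear₁ (x * x ^^ k) (bin-ratio n k)
  (solve 6 (λ x n k a b y → (1+ k) :* (b :* (x :* y)) :- x :* ((n :- k) :* (a :* y)) :=
      x :* y :* ((1+ k) :* b :- (n :- k) :* a))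
    refl x (ι n) (ι k) (bin n k) (bin n (suc k)) (x ^^ k))

-- The row index m varies while the weight stays fixed, so that recurrences in m alone apply, even
-- where the weight is itself a row of binomials.
pair : ℕ → (ℕ → ℚ) → ℕ → ℚ
pair N w m = sumℚ N (λ k → bin m k * w k)

pair-0 : ∀ N w → pair (suc N) w 0 ≡ w 0
pair-0 N w = begin
  pair (suc N) w 0                                          ≡⟨ sum-head N (λ k → bin 0 k * w k) ⟩
  1ℚ * w 0 + sumℚ N (λ k → bin 0 (suc k) * w (suc k))
    ≡⟨ cong₂ _+_ (*-identityˡ (w 0)) (trans (sum-ext N
        (λ k → trans (cong (_* w (suc k)) (bin-vanish {0} {suc k} (s≤s z≤n))) (*-zeroˡ (w (suc k))))) (sum-0 N)) ⟩
  w 0 + 0ℚ                                                  ≡⟨ +-identityʳ (w 0) ⟩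
  w 0                                                       ∎

-- Coefficientwise form of the differential equation of (1 - X)^(-n-1) (1 + (x - 1) X)^n,
-- the generating function of m ↦ Σₖ C(m,k) C(n,k) xᵏ.
pair-recurrence₀ : ∀ x n m → let S = pair (suc n) (binw x n) in
  ι (suc m) * S (suc m) ≡
  (ι n * x + 1ℚ - (x - 2ℚ) * ι m) * S m + (x - 1ℚ) * sumℚ (suc n) (λ k → (ι m - ι k) * bin m k * binw x n k)
pair-recurrence₀ x n m = linear₁ 1ℚ telescoped (solve 3 (λ a b c → a :- (b :+ c) := # 1 :* (a :- (b :+ c) :- # 0))
    refl
    (ι (suc m) * S (suc m)) (u * S m) (v * S′))
  where
  u v S′ : ℚ
  u = ι n * x + 1ℚ - (x - 2ℚ) * ι m
  v = x - 1ℚ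
  S′ = sumℚ (suc n) (λ k → (ι m - ι k) * bin m k * binw x n k)
  S : ℕ → ℚ
  S = pair (suc n) (binw x n)
  -- Telescoping certificate; at the upper end it vanishes through the factor n - k at k = n.
  F : ℕ → ℚ
  F zero    = 0ℚ
  F (suc k) = - (x * (ι n - ι k) * binw x n k * bin m k)
  term : ∀ k → ι (suc m) * (bin (suc m) k * binw x n k)
             - (u * (bin m k * binw x n k) + v * ((ι m - ι k) * bin m k * binw x n k)) ≡ F (suc k) - F k
  term zero rewrite bin-0 m =
    solve 4 (λ x n m c → (1+ m) :* (# 1 :* c) :- ((n :* x :+ # 1 :- (x :- # 2) :* m) :* (# 1 :* c) :+ (x :- # 1) :*
        ((m :- # 0) :* # 1 :* c))
                   := :- (x :* (n :- # 0) :* c :* # 1) :- # 0) refl x (ι n) (ι m) (binw x n 0)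
  term (suc k) = linear₃ (ι (suc m) * c′) (- c′) b (bin-pascal m k) (bin-ratio m k) (binw-ratio x n k)
    (solve 9 (λ x n m k b b′ b″ c c′ →
       (1+ m) :* (b″ :* c′) :- ((n :* x :+ # 1 :- (x :- # 2) :* m) :* (b′ :* c′) :+ (x :- # 1) :*
           ((m :- (1+ k)) :* b′ :* c′))
         :- (:- (x :* (n :- (1+ k)) :* c′ :* b′) :- (:- (x :* (n :- k) :* c :* b)))
       := (1+ m) :* c′ :* (b″ :- (b :+ b′)) :+ (:- c′) :* ((1+ k) :* b′ :- (m :- k) :* b) :+ b :*
           ((1+ k) :* c′ :- x :* ((n :- k) :* c)))
      refl x (ι n) (ι m) (ι k) b (bin m (suc k)) (bin (suc m) (suc k)) (binw x n k) c′)
    where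
    b c′ : ℚ
    b = bin m k
    c′ = binw x n (suc k)
  telescoped : ι (suc m) * S (suc m) - (u * S m + v * S′) ≡ 0ℚ
  telescoped = begin
    ι (suc m) * S (suc m) - (u * S m + v * S′)
      ≡⟨ cong₂ (λ a b → a - b) (sym (sum-* (ι (suc m)) (suc n) _)) (sym (sum-linear u v (suc n) _ _)) ⟩
    sumℚ (suc n) X - sumℚ (suc n) Y
      ≡⟨ solve 2 (λ a b → a :- b := # 1 :* a :+ (:- # 1) :* b) refl (sumℚ (suc n) X) (sumℚ (suc n) Y) ⟩
    1ℚ * sumℚ (suc n) X + -1ℚ * sumℚ (suc n) Y
      ≡⟨ sum-linear 1ℚ -1ℚ (suc n) X Y ⟨
    sumℚ (suc n) (λ k → 1ℚ * X k + -1ℚ * Y k)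
      ≡⟨ sum-ext (suc n) (λ k → trans (solve 2 (λ a b → # 1 :* a :+ (:- # 1) :* b := a :- b) refl (X k) (Y k))
          (term k)) ⟩
    sumℚ (suc n) (λ k → F (suc k) - F k)
      ≡⟨ sum-telescope (suc n) F ⟩
    F (suc n) - 0ℚ
      ≡⟨ solve 4 (λ x n c b → :- (x :* (n :- n) :* c :* b) :- # 0 := # 0) refl x (ι n) (binw x n n) (bin m n) ⟩
    0ℚ ∎
    where
    X Y : ℕ → ℚ
    X k = ι (suc m) * (bin (suc m) k * binw x n k)
    Y k = u * (bin m k * binw x n k) + v * ((ι m - ι k) * bin m k * binw x n k)

-- At row m + 1 the factor m + 1 - k lowers C(m+1,k) to (m+1) C(m,k), so the extra sum of
-- `pair-recurrence₀` becomes `S m` and the recurrence closes.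
pair-recurrence : ∀ x n m → let S = pair (suc n) (binw x n) in
  ι (suc (suc m)) * S (suc (suc m)) ≡
  (ι n * x + 1ℚ - (x - 2ℚ) * ι (suc m)) * S (suc m) + (x - 1ℚ) * ι (suc m) * S m
pair-recurrence x n m = trans (pair-recurrence₀ x n (suc m)) (cong ((ι n * x + 1ℚ - (x - 2ℚ) * ι (suc m)) * pair
    (suc n) (binw x n) (suc m) +_) (trans (cong ((x - 1ℚ) *_) lowered) (sym (*-assoc (x - 1ℚ) (ι (suc m)) _))))
  where
  lowered : sumℚ (suc n) (λ k → (ι (suc m) - ι k) * bin (suc m) k * binw x n k) ≡ ι (suc m) * pair (suc n) (binw x n)
      m
  lowered = trans (sum-ext (suc n) (λ k → trans (cong (_* binw x n k) (bin-lower m k)) (*-assoc (ι (suc m)) (bin m k)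
      (binw x n k))))
    (sum-* (ι (suc m)) (suc n) _)

pair-1 : ∀ x n → pair (suc n) (binw x n) 1 ≡ ι n * x + 1ℚ
pair-1 x n = begin
  pair (suc n) (binw x n) 1                ≡⟨ *-identityˡ _ ⟨
  ι 1 * pair (suc n) (binw x n) 1          ≡⟨ pair-recurrence₀ x n 0 ⟩
  (ι n * x + 1ℚ - (x - 2ℚ) * 0ℚ) * pair (suc n) (binw x n) 0 + (x - 1ℚ) * sumℚ (suc n) (λ k → (0ℚ - ι k) * bin 0 k *
      binw x n k)
    ≡⟨ cong₂ (λ a b → (ι n * x + 1ℚ - (x - 2ℚ) * 0ℚ) * a + (x - 1ℚ) * b) (trans (pair-0 n (binw x n))
        (trans (*-identityʳ (bin n 0)) (bin-0 n))) (trans (sum-ext (suc n) none) (sum-0 (suc n))) ⟩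
  (ι n * x + 1ℚ - (x - 2ℚ) * 0ℚ) * 1ℚ + (x - 1ℚ) * 0ℚ
    ≡⟨ solve 2 (λ n x → (n :* x :+ # 1 :- (x :- # 2) :* # 0) :* # 1 :+ (x :- # 1) :* # 0 := n :* x :+ # 1) refl (ι n)
        x ⟩
  ι n * x + 1ℚ                             ∎
  where
  none : ∀ k → (0ℚ - ι k) * bin 0 k * binw x n k ≡ 0ℚ
  none zero    = solve 1 (λ c → (# 0 :- # 0) :* # 1 :* c := # 0) refl (binw x n 0)
  none (suc k) rewrite bin-vanish {0} {suc k} (s≤s z≤n) =
    solve 2 (λ a c → (# 0 :- a) :* # 0 :* c := # 0) refl (ι (suc k)) (binw x n (suc k))

-- Binomial sums with denominators k.

harm : ℕ → ℚ
harm n = sumℚ n 1/suc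

pairHarm : ℕ → (ℕ → ℚ) → ℕ → ℚ
pairHarm N w m = sumℚ N (λ k → bin m (suc k) * w (suc k) * 1/suc k)

bin/suc : ∀ m k → bin m k * 1/suc k ≡ 1/suc m * bin (suc m) (suc k)
bin/suc m k = linear₃ (- (1/suc m * 1/suc k)) (- (bin m k * 1/suc k)) (1/suc m * bin (suc m) (suc k))
    (bin-absorb m k) (*-1/suc m) (*-1/suc k)
  (solve 6 (λ a b s t i j → a :* i :- j :* b :=
      (:- (j :* i)) :* (t :* b :- s :* a) :+ (:- (a :* i)) :* (s :* j :- # 1) :+ (j :* b) :* (t :* i :- # 1))
    refl (bin m k) (bin (suc m) (suc k)) (ι (suc m)) (ι (suc k)) (1/suc k) (1/suc m))

-- Pascal's rule isolates the increment, and C(m,k)/(k+1) = C(m+1,k+1)/(m+1) removes the varying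
-- denominator. The -1 discards the term of index 0.
pairHarm-suc : ∀ N w m → w 0 ≡ 1ℚ → pairHarm N w (suc m) ≡ pairHarm N w m + 1/suc m * (pair (suc N) w (suc m) - 1ℚ)
pairHarm-suc N w m w0 = begin
  pairHarm N w (suc m)
    ≡⟨ sum-ext N term ⟩
  sumℚ N (λ k → bin m (suc k) * w (suc k) * 1/suc k + 1/suc m * (bin (suc m) (suc k) * w (suc k)))
    ≡⟨ sum-+ N _ _ ⟩
  pairHarm N w m + sumℚ N (λ k → 1/suc m * (bin (suc m) (suc k) * w (suc k)))
    ≡⟨ cong (pairHarm N w m +_) (sum-* (1/suc m) N _) ⟩
  pairHarm N w m + 1/suc m * sumℚ N (λ k → bin (suc m) (suc k) * w (suc k))
    ≡⟨ cong (λ a → pairHarm N w m + 1/suc m * a) (linear₂ -1ℚ -1ℚ (sum-head N (λ k → bin (suc m) k * w k)) w0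
        (solve 3 (λ t s v → t :- (s :- # 1) := (:- # 1) :* (s :- (# 1 :* v :+ t)) :+ (:- # 1) :* (v :- # 1)) refl
          (sumℚ N (λ k → bin (suc m) (suc k) * w (suc k))) (pair (suc N) w (suc m)) (w 0))) ⟩
  pairHarm N w m + 1/suc m * (pair (suc N) w (suc m) - 1ℚ) ∎
  where
  term : ∀ k → bin (suc m) (suc k) * w (suc k) * 1/suc k ≡ bin m (suc k) * w (suc k) * 1/suc k + 1/suc m *
      (bin (suc m) (suc k) * w (suc k))
  term k = linear₂ (w (suc k) * 1/suc k) (w (suc k)) (bin-pascal m k) (bin/suc m k)
    (solve 6 (λ a b c w i j → c :* w :* i :- (b :* w :* i :+ j :* (c :* w)) :=
        w :* i :* (c :- (a :+ b)) :+ w :* (a :* i :- j :* c))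
      refl (bin m k) (bin m (suc k)) (bin (suc m) (suc k)) (w (suc k)) (1/suc k) (1/suc m))

pairHarm-0 : ∀ N w → pairHarm N w 0 ≡ 0ℚ
pairHarm-0 N w = trans (sum-ext N (λ k → trans (cong (λ b → b * w (suc k) * 1/suc k) (bin-vanish {0} {suc k}
    (s≤s z≤n)))
  (solve 2 (λ a b → # 0 :* a :* b := # 0) refl (w (suc k)) (1/suc k)))) (sum-0 N)

-- Iterating the increment trades the denominators k inside the binomial sum for denominators j
-- outside: it is enough to know the sums `pair` for all smaller rows.
pairHarm-sum : ∀ N w m → w 0 ≡ 1ℚ → pairHarm N w m ≡ sumℚ m (λ j → pair (suc N) w (suc j) * 1/suc j) - harm m
pairHarm-sum N w zero    w0 = pairHarm-0 N w
pairHarm-sum N w (suc m) w0 = trans (pairHarm-suc N w m w0)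
    (trans (cong (_+ 1/suc m * (a - 1ℚ)) (pairHarm-sum N w m w0))
  (solve 4 (λ s h i a → s :- h :+ i :* (a :- # 1) := s :+ a :* i :- (h :+ i)) refl
      (sumℚ m (λ j → pair (suc N) w (suc j) * 1/suc j)) (harm m) (1/suc m) a))
  where
  a : ℚ
  a = pair (suc N) w (suc m)

sgn : ℕ → ℚ
sgn = -1ℚ ^^_

sgn-sq : ∀ k → sgn k * sgn k ≡ 1ℚ
sgn-sq zero    = refl
sgn-sq (suc k) = trans (solve 1 (λ s → ((:- # 1) :* s) :* ((:- # 1) :* s) := s :* s) refl (sgn k)) (sgn-sq k)

-- A truncated alternating row sum telescopes by Pascal's rule. The cut-off r is kept free because
-- it is used both at the full row and at half of it.
pair-sgn : ∀ r m → pair (suc r) sgn (suc m) ≡ sgn r * bin m r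
pair-sgn zero    m = sym (cong (1ℚ *_) (bin-0 m))
pair-sgn (suc r) m = trans (cong (_+ bin (suc m) (suc r) * sgn (suc r)) (pair-sgn r m))
  (linear₁ (sgn (suc r)) (bin-pascal m r)
    (solve 4 (λ s a b c → s :* a :+ c :* ((:- # 1) :* s) :- (:- # 1) :* s :* b := (:- # 1) :* s :* (c :- (a :+ b)))
      refl (sgn r) (bin m r) (bin m (suc r)) (bin (suc m) (suc r))))

pairHarm-sgn : ∀ n → pairHarm n sgn n ≡ - harm n
pairHarm-sgn n = trans (pairHarm-sum n sgn n refl) (trans (cong (_- harm n) (trans (sum-cong n vanish) (sum-0 n)))
    (+-identityˡ (- harm n)))
  where
  vanish : ∀ j → j ℕ.< n → pair (suc n) sgn (suc j) * 1/suc j ≡ 0ℚ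
  vanish j j<n = trans (cong (_* 1/suc j) (trans (pair-sgn n j) (trans (cong (sgn n *_) (bin-vanish j<n))
      (*-zeroʳ (sgn n))))) (*-zeroˡ (1/suc j))

-- Alternating sums of squared binomials, without and with denominators.

-- `dbl (suc r)` reduces to two successors, which is what the parity inductions step over.
dbl : ℕ → ℕ
dbl zero    = zero
dbl (suc n) = suc (suc (dbl n))

ι-dbl : ∀ n → ι (dbl n) ≡ 2ℚ * ι n
ι-dbl zero    = refl
ι-dbl (suc n) = trans (cong (λ x → 1ℚ + (1ℚ + x)) (ι-dbl n)) (solve 1 (λ n → 1+ 1+ (# 2 :* n) := # 2 :* (1+ n)) refl
    (ι n))

altSq altMix : ℕ → ℚ
altSq  n = pair (suc n) (binw -1ℚ n) n
altMix n = pair (suc n) (binw -1ℚ n) (suc n)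

-- For a = C(n,k) and b = C(n,k+1) one has (a+b)² - 2(a+b)b + 2b² = a² + b², and under alternating
-- signs a² + b² telescopes.
altSq-suc : ∀ n → altSq (suc n) ≡ 2ℚ * altMix n - 2ℚ * altSq n
altSq-suc n = linear₁ 1ℚ telescoped (solve 3 (λ a b c → a :- (# 2 :* b :- # 2 :* c) := # 1 :*
    (a :+ (:- # 2) :* b :+ # 2 :* c :- # 0)) refl (altSq (suc n)) (altMix n) (altSq n))
  where
  X Y Z F : ℕ → ℚ
  X k = bin (suc n) k * binw -1ℚ (suc n) k
  Y k = bin (suc n) k * binw -1ℚ n k
  Z k = bin n k * binw -1ℚ n k
  F zero    = 0ℚ
  F (suc k) = Z k
  extend : ∀ (f : ℕ → ℚ) → f (suc n) ≡ 0ℚ → sumℚ (suc n) f ≡ sumℚ (suc (suc n)) f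
  extend f e = trans (sym (+-identityʳ (sumℚ (suc n) f))) (cong (sumℚ (suc n) f +_) (sym e))
  binw-top : binw -1ℚ n (suc n) ≡ 0ℚ
  binw-top = trans (cong (_* sgn (suc n)) (bin-vanish {n} {suc n} ℕₚ.≤-refl)) (*-zeroˡ (sgn (suc n)))
  Y-top : Y (suc n) ≡ 0ℚ
  Y-top = trans (cong (bin (suc n) (suc n) *_) binw-top) (*-zeroʳ (bin (suc n) (suc n)))
  Z-top : Z (suc n) ≡ 0ℚ
  Z-top = trans (cong (bin n (suc n) *_) binw-top) (*-zeroʳ (bin n (suc n)))
  term : ∀ k → X k + - 2ℚ * Y k + 2ℚ * Z k ≡ F (suc k) - F k
  term zero rewrite bin-0 n = refl
  term (suc k) rewrite bin-pascal n k =
    solve 3 (λ a b s → (a :+ b) :* ((a :+ b) :* ((:- # 1) :* s)) :+ (:- # 2) :* ((a :+ b) :* (b :* ((:- # 1) :* s)))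
        :+ # 2 :* (b :* (b :* ((:- # 1) :* s)))
                    := b :* (b :* ((:- # 1) :* s)) :- a :* (a :* s)) refl (bin n k) (bin n (suc k)) (sgn k)
  telescoped : altSq (suc n) + - 2ℚ * altMix n + 2ℚ * altSq n ≡ 0ℚ
  telescoped = begin
    altSq (suc n) + - 2ℚ * altMix n + 2ℚ * altSq n
      ≡⟨ cong₂ (λ a b → altSq (suc n) + - 2ℚ * a + 2ℚ * b) (extend Y Y-top) (extend Z Z-top) ⟩
    sumℚ N X + - 2ℚ * sumℚ N Y + 2ℚ * sumℚ N Z
      ≡⟨ cong₂ (λ a b → sumℚ N X + a + b) (sum-* (- 2ℚ) N Y) (sum-* 2ℚ N Z) ⟨
    sumℚ N X + sumℚ N (λ k → - 2ℚ * Y k) + sumℚ N (λ k → 2ℚ * Z k)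
      ≡⟨ cong (_+ sumℚ N (λ k → 2ℚ * Z k)) (sum-+ N X (λ k → - 2ℚ * Y k)) ⟨
    sumℚ N (λ k → X k + - 2ℚ * Y k) + sumℚ N (λ k → 2ℚ * Z k)
      ≡⟨ sum-+ N (λ k → X k + - 2ℚ * Y k) (λ k → 2ℚ * Z k) ⟨
    sumℚ N (λ k → X k + - 2ℚ * Y k + 2ℚ * Z k)
      ≡⟨ sum-ext N term ⟩
    sumℚ N (λ k → F (suc k) - F k)
      ≡⟨ sum-telescope N F ⟩
    Z (suc n) - 0ℚ
      ≡⟨ trans (+-identityʳ (Z (suc n))) Z-top ⟩
    0ℚ ∎
    where
    N : ℕ
    N = suc (suc n)

altMix-symmetric : ∀ n → pair (suc (suc n)) (binw -1ℚ (suc n)) n ≡ altMix n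
altMix-symmetric n = trans
  (cong₂ _+_
    (sum-ext (suc n) (λ k → solve 3 (λ a b c → a :* (b :* c) := b :* (a :* c)) refl (bin n k) (bin (suc n) k)
        (sgn k)))
    (trans (cong (_* binw -1ℚ (suc n) (suc n)) (bin-vanish {n} {suc n} ℕₚ.≤-refl))
        (*-zeroˡ (binw -1ℚ (suc n) (suc n)))))
  (+-identityʳ (altMix n))

-- This is the three-term recurrence at x = -1 around the diagonal: both off-diagonal neighbours are
-- `altMix` values, one of them after exchanging the two rows.
altMix-suc : ∀ n → ι (suc (suc n)) * altMix (suc n) ≡ (2ℚ * ι (suc n) + 1ℚ) * altSq (suc n) - 2ℚ * ι (suc n) * altMix
    n
altMix-suc n = trans (pair-recurrence -1ℚ (suc n) n)
    (trans (cong (λ a → (s * -1ℚ + 1ℚ - (-1ℚ - 2ℚ) * s) * altSq (suc n) + (-1ℚ - 1ℚ) * s * a) (altMix-symmetric n))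
    (solve 3 (λ s a b → (s :* (:- # 1) :+ # 1 :- ((:- # 1) :- # 2) :* s) :* a :+ ((:- # 1) :- # 1) :* s :* b :=
        (# 2 :* s :+ # 1) :* a :- # 2 :* s :* b)
      refl s (altSq (suc n)) (altMix n)))
  where
  s : ℚ
  s = ι (suc n)

central : ℕ → ℚ
central r = sgn r * bin (dbl r) r

bin-central : ∀ r → bin (suc (dbl r)) (suc r) ≡ bin (suc (dbl r)) r
bin-central r = *-cancel-suc r (trans (bin-ratio (suc (dbl r)) r)
  (cong (_* bin (suc (dbl r)) r) (trans (cong (λ x → (1ℚ + x) - ι r) (ι-dbl r))
      (solve 1 (λ r → (1+ (# 2 :* r)) :- r := 1+ r) refl (ι r)))))

bin-central-suc : ∀ r → bin (dbl (suc r)) (suc r) ≡ 2ℚ * bin (suc (dbl r)) (suc r)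
bin-central-suc r = linear₂ 1ℚ -1ℚ (bin-pascal (suc (dbl r)) r) (bin-central r)
  (solve 3 (λ a b c → a :- # 2 :* b := # 1 :* (a :- (c :+ b)) :+ (:- # 1) :* (b :- c)) refl
      (bin (dbl (suc r)) (suc r)) (bin (suc (dbl r)) (suc r)) (bin (suc (dbl r)) r))

central-recurrence : ∀ r → ι (suc r) * bin (dbl (suc r)) (suc r) ≡ 2ℚ * (1ℚ + 2ℚ * ι r) * bin (dbl r) r
central-recurrence r = linear₃ 1ℚ 2ℚ (2ℚ * bin (dbl r) r - 2ℚ * bin (suc (dbl r)) r + ι 1 * bin (suc (dbl r)) r)
    (bin-absorb (suc (dbl r)) r) (bin-lower (dbl r) r) (ι-dbl r)
  (solve 5 (λ r d a b c → (1+ r) :* c :- # 2 :* (# 1 :+ # 2 :* r) :* a :=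
     # 1 :* ((1+ r) :* c :- (1+ 1+ d) :* b) :+ # 2 :* (((1+ d) :- r) :* b :- (1+ d) :* a) :+
         (# 2 :* a :- # 2 :* b :+ # 1 :* b) :* (d :- # 2 :* r))
    refl (ι r) (ι (dbl r)) (bin (dbl r) r) (bin (suc (dbl r)) r) (bin (dbl (suc r)) (suc r)))

central-suc : ∀ r → ι (suc r) * central (suc r) ≡ - 2ℚ * (1ℚ + 2ℚ * ι r) * central r
central-suc r = linear₁ (-1ℚ * sgn r) (central-recurrence r)
  (solve 4 (λ r s a b → (1+ r) :* ((:- # 1) :* s :* b) :- (:- # 2) :* (# 1 :+ # 2 :* r) :* (s :* a) :=
      (:- # 1) :* s :* ((1+ r) :* b :- # 2 :* (# 1 :+ # 2 :* r) :* a))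
    refl (ι r) (sgn r) (bin (dbl r) r) (bin (dbl (suc r)) (suc r)))

mutual
  -- The recurrences `altSq-suc` and `altMix-suc` run in a cycle of period two: equality at an even
  -- index makes `altSq` vanish at the next one, vanishing gives `altSq` = 2 `altMix` one step
  -- later, and this cancels the cross term so that equality returns.
  altMix-even : ∀ r → altMix (dbl r) ≡ altSq (dbl r)
  altMix-even zero    = refl
  altMix-even (suc r) = *-cancel-suc (suc (suc (dbl r))) (linear₂ 1ℚ (ι (suc (suc (dbl r))))
    (altMix-suc (suc (dbl r))) (altSq≡2altMix r)
    (solve 4 (λ d a b c → (1+ d) :* a :- (1+ d) :* b :=
        # 1 :* ((1+ d) :* a :- ((# 2 :* d :+ # 1) :* b :- # 2 :* d :* c)) :+ d :* (b :- # 2 :* c))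
      refl (ι (suc (suc (dbl r)))) (altMix (dbl (suc r))) (altSq (dbl (suc r))) (altMix (suc (dbl r)))))

  altSq-odd : ∀ r → altSq (suc (dbl r)) ≡ 0ℚ
  altSq-odd r = linear₂ 1ℚ 2ℚ (altSq-suc (dbl r)) (altMix-even r)
    (solve 3 (λ a b c → a :- # 0 := # 1 :* (a :- (# 2 :* b :- # 2 :* c)) :+ # 2 :* (b :- c)) refl
        (altSq (suc (dbl r))) (altMix (dbl r)) (altSq (dbl r)))

  altSq≡2altMix : ∀ r → altSq (dbl (suc r)) ≡ 2ℚ * altMix (suc (dbl r))
  altSq≡2altMix r = linear₂ 1ℚ (- 2ℚ) (altSq-suc (suc (dbl r))) (altSq-odd r)
    (solve 3 (λ a b c → a :- # 2 :* b := # 1 :* (a :- (# 2 :* b :- # 2 :* c)) :+ (:- # 2) :* (c :- # 0)) refl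
      (altSq (dbl (suc r))) (altMix (suc (dbl r))) (altSq (suc (dbl r))))

altMix-odd : ∀ r → ι (suc r) * altMix (suc (dbl r)) ≡ - (1ℚ + 2ℚ * ι r) * altSq (dbl r)
altMix-odd r = linear₃ ½ (½ * (2ℚ * (1ℚ + 2ℚ * ι r) + 1ℚ)) (- (1ℚ + 2ℚ * ι r))
  (subst (λ d → (1ℚ + (1ℚ + d)) * altMix (suc (dbl r)) ≡ (2ℚ * (1ℚ + d) + 1ℚ) * altSq (suc (dbl r)) - 2ℚ * (1ℚ + d) *
      altMix (dbl r)) (ι-dbl r) (altMix-suc (dbl r)))
  (altSq-odd r) (altMix-even r)
  (solve 5 (λ r a b c d → (1+ r) :* a :- (:- (# 1 :+ # 2 :* r)) :* d :=
      con ½ :* ((1+ 1+ (# 2 :* r)) :* a :- ((# 2 :* (1+ (# 2 :* r)) :+ # 1) :* b :- # 2 :* (1+ (# 2 :* r)) :* c))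
      :+ con ½ :* (# 2 :* (# 1 :+ # 2 :* r) :+ # 1) :* (b :- # 0) :+ (:- (# 1 :+ # 2 :* r)) :* (c :- d))
    refl (ι r) (altMix (suc (dbl r))) (altSq (suc (dbl r))) (altMix (dbl r)) (altSq (dbl r)))

altSq-even : ∀ r → altSq (dbl r) ≡ central r
altSq-even zero    = refl
altSq-even (suc r) = *-cancel-suc r (begin
  ι (suc r) * altSq (dbl (suc r))
    ≡⟨ linear₂ (ι (suc r)) 2ℚ (altSq≡2altMix r) (altMix-odd r)
        (solve 4 (λ r a b c → (1+ r) :* a :- (:- # 2) :* (# 1 :+ # 2 :* r) :* c := (1+ r) :* (a :- # 2 :* b) :+ # 2
            :* ((1+ r) :* b :- (:- (# 1 :+ # 2 :* r)) :* c))
          refl (ι r) (altSq (dbl (suc r))) (altMix (suc (dbl r))) (altSq (dbl r))) ⟩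
  - 2ℚ * (1ℚ + 2ℚ * ι r) * altSq (dbl r)
    ≡⟨ cong (- 2ℚ * (1ℚ + 2ℚ * ι r) *_) (altSq-even r) ⟩
  - 2ℚ * (1ℚ + 2ℚ * ι r) * central r
    ≡⟨ central-suc r ⟨
  ι (suc r) * central (suc r) ∎)

sqHarm : ℕ → ℚ
sqHarm n = sumℚ n (λ k → bin n (suc k) * binw -1ℚ n (suc k) * 1/suc k)

-- C(n+1,k)² - C(n,k)² = C(n,k-1) (C(n+1,k) + C(n,k)), and C(n,k-1)/k = C(n+1,k)/(n+1). The -2
-- removes the two terms with k = 0.
sqHarm-suc : ∀ n → sqHarm (suc n) ≡ sqHarm n + 1/suc n * (altSq (suc n) + altMix n - 2ℚ)
sqHarm-suc n = begin
  sqHarm (suc n)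
    ≡⟨ sum-ext (suc n) term ⟩
  sumℚ (suc n) (λ k → X k + i * (Y k + Z k))
    ≡⟨ trans (sum-+ (suc n) X (λ k → i * (Y k + Z k))) (cong (sumℚ (suc n) X +_)
        (trans (sum-* i (suc n) (λ k → Y k + Z k)) (cong (i *_) (sum-+ (suc n) Y Z)))) ⟩
  sumℚ (suc n) X + i * (sumℚ (suc n) Y + sumℚ (suc n) Z)
    ≡⟨ cong₂ (λ a b → a + i * b) (top X X-top) (cong₂ _+_ Y-sum (trans (top Z Z-top) Z-sum)) ⟩
  sqHarm n + i * ((altSq (suc n) - 1ℚ) + (altMix n - 1ℚ))
    ≡⟨ solve 4 (λ s i a b → s :+ i :* ((a :- # 1) :+ (b :- # 1)) := s :+ i :* (a :+ b :- # 2)) refl (sqHarm n) i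
        (altSq (suc n)) (altMix n) ⟩
  sqHarm n + i * (altSq (suc n) + altMix n - 2ℚ) ∎
  where
  i : ℚ
  i = 1/suc n
  X Y Z : ℕ → ℚ
  X k = bin n (suc k) * binw -1ℚ n (suc k) * 1/suc k
  Y k = bin (suc n) (suc k) * binw -1ℚ (suc n) (suc k)
  Z k = bin (suc n) (suc k) * binw -1ℚ n (suc k)
  binw-top : binw -1ℚ n (suc n) ≡ 0ℚ
  binw-top = trans (cong (_* sgn (suc n)) (bin-vanish {n} {suc n} ℕₚ.≤-refl)) (*-zeroˡ (sgn (suc n)))
  X-top : X n ≡ 0ℚ
  X-top = trans (cong (λ a → bin n (suc n) * a * 1/suc n) binw-top) (solve 2 (λ a b → a :* # 0 :* b := # 0) refl
      (bin n (suc n)) (1/suc n))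
  Z-top : Z n ≡ 0ℚ
  Z-top = trans (cong (bin (suc n) (suc n) *_) binw-top) (*-zeroʳ (bin (suc n) (suc n)))
  top : ∀ (f : ℕ → ℚ) → f n ≡ 0ℚ → sumℚ (suc n) f ≡ sumℚ n f
  top f e = trans (cong (sumℚ n f +_) e) (+-identityʳ (sumℚ n f))
  drop-head : ∀ N f → f 0 ≡ 1ℚ → sumℚ N (f ∘ suc) ≡ sumℚ (suc N) f - 1ℚ
  drop-head N f e = linear₂ -1ℚ -1ℚ (sum-head N f) e
    (solve 3 (λ t s v → t :- (s :- # 1) := (:- # 1) :* (s :- (v :+ t)) :+ (:- # 1) :* (v :- # 1)) refl
        (sumℚ N (f ∘ suc)) (sumℚ (suc N) f) (f 0))
  Y-sum : sumℚ (suc n) Y ≡ altSq (suc n) - 1ℚ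
  Y-sum = drop-head (suc n) (λ k → bin (suc n) k * binw -1ℚ (suc n) k) refl
  Z-sum : sumℚ n Z ≡ altMix n - 1ℚ
  Z-sum = drop-head n (λ k → bin (suc n) k * binw -1ℚ n k) (cong (λ b → 1ℚ * (b * 1ℚ)) (bin-0 n))
  term : ∀ k → bin (suc n) (suc k) * binw -1ℚ (suc n) (suc k) * 1/suc k ≡ X k + i * (Y k + Z k)
  term k = linear₂ (sgn (suc k) * 1/suc k * (bin (suc n) (suc k) + bin n (suc k)))
      (sgn (suc k) * (bin (suc n) (suc k) + bin n (suc k))) (bin-pascal n k) (bin/suc n k)
    (solve 6 (λ a b c s j i → c :* (c :* s) :* j :- (b :* (b :* s) :* j :+ i :* (c :* (c :* s) :+ c :* (b :* s))) :=
        s :* j :* (c :+ b) :* (c :- (a :+ b)) :+ s :* (c :+ b) :* (a :* j :- i :* c))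
      refl (bin n k) (bin n (suc k)) (bin (suc n) (suc k)) (sgn (suc k)) (1/suc k) i)

1/suc-dbl : ∀ r → 1/suc r ≡ 2ℚ * 1/suc (suc (dbl r))
1/suc-dbl r = *-cancel-suc r (linear₃ 1ℚ -1ℚ (1/suc (suc (dbl r))) (*-1/suc r) (*-1/suc (suc (dbl r))) (ι-dbl r)
  (solve 4 (λ r d i j → (1+ r) :* i :- (1+ r) :* (# 2 :* j) :=
      # 1 :* ((1+ r) :* i :- # 1) :+ (:- # 1) :* ((1+ 1+ d) :* j :- # 1) :+ j :* (d :- # 2 :* r))
    refl (ι r) (ι (dbl r)) (1/suc r) (1/suc (suc (dbl r)))))

mutual
  -- Increments agree: on the left they are signed central binomials by the evaluations above, on
  -- the right they are alternating row sums cut off at half the row, which `pair-sgn` makes the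
  -- same central binomials.
  sqHarm-odd : ∀ r → sqHarm (suc (dbl r)) ≡ pairHarm r sgn (suc (dbl r)) - harm (suc (dbl r))
  sqHarm-odd r = begin
    sqHarm (suc (dbl r))
      ≡⟨ sqHarm-suc (dbl r) ⟩
    sqHarm (dbl r) + i * (altSq (suc (dbl r)) + altMix (dbl r) - 2ℚ)
      ≡⟨ cong₂ (λ s a → s + i * (a - 2ℚ)) (sqHarm-even r) (cong₂ _+_ (altSq-odd r)
          (trans (altMix-even r) (altSq-even r))) ⟩
    P - harm (dbl r) + i * (0ℚ + central r - 2ℚ)
      ≡⟨ solve 4 (λ p h i c → p :- h :+ i :* (# 0 :+ c :- # 2) := p :+ i :* (c :- # 1) :- (h :+ i)) refl P
          (harm (dbl r)) i (central r) ⟩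
    P + i * (central r - 1ℚ) - harm (suc (dbl r))
      ≡⟨ cong (_- harm (suc (dbl r))) (trans (cong (λ a → P + i * (a - 1ℚ)) (sym (pair-sgn r (dbl r))))
          (sym (pairHarm-suc r sgn (dbl r) refl))) ⟩
    pairHarm r sgn (suc (dbl r)) - harm (suc (dbl r)) ∎
    where
    i P : ℚ
    i = 1/suc (dbl r)
    P = pairHarm r sgn (dbl r)

  sqHarm-even : ∀ r → sqHarm (dbl r) ≡ pairHarm r sgn (dbl r) - harm (dbl r)
  sqHarm-even zero    = refl
  sqHarm-even (suc r) = begin
    sqHarm (dbl (suc r))
      ≡⟨ sqHarm-suc (suc (dbl r)) ⟩
    sqHarm (suc (dbl r)) + i * (altSq (dbl (suc r)) + altMix (suc (dbl r)) - 2ℚ)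
      ≡⟨ cong₂ (λ s a → s + i * (a - 2ℚ)) (sqHarm-odd r) (cong₂ _+_ altSq≡2β altMix≡β) ⟩
    P - H + i * (2ℚ * β + β - 2ℚ)
      ≡⟨ solve 4 (λ p h i b → p :- h :+ i :* (# 2 :* b :+ b :- # 2) := p :+ b :* (# 2 :* i) :+ i :* (b :- # 1) :-
          (h :+ i)) refl P H i β ⟩
    P + β * (2ℚ * i) + i * (β - 1ℚ) - harm (dbl (suc r))
      -- The cut-off moves from r to r + 1: the new term β/(r+1) = 2β/(2r+2) is supplied by `altSq`
      -- = 2β.
      ≡⟨ cong (λ a → P + a + i * (β - 1ℚ) - harm (dbl (suc r)))
           (cong₂ _*_ (*-comm (sgn (suc r)) (bin (suc (dbl r)) (suc r))) (sym (1/suc-dbl r))) ⟩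
    pairHarm (suc r) sgn (suc (dbl r)) + i * (β - 1ℚ) - harm (dbl (suc r))
      ≡⟨ cong (_- harm (dbl (suc r))) (trans (cong (λ a → pairHarm (suc r) sgn (suc (dbl r)) + i * (a - 1ℚ))
          (sym (pair-sgn (suc r) (suc (dbl r)))))
           (sym (pairHarm-suc (suc r) sgn (suc (dbl r)) refl))) ⟩
    pairHarm (suc r) sgn (dbl (suc r)) - harm (dbl (suc r)) ∎
    where
    i P H β : ℚ
    i = 1/suc (suc (dbl r))
    P = pairHarm r sgn (suc (dbl r))
    H = harm (suc (dbl r))
    β = sgn (suc r) * bin (suc (dbl r)) (suc r)
    altSq≡2β : altSq (dbl (suc r)) ≡ 2ℚ * β
    altSq≡2β = trans (altSq-even (suc r)) (trans (cong (sgn (suc r) *_) (bin-central-suc r))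
      (solve 2 (λ s b → s :* (# 2 :* b) := # 2 :* (s :* b)) refl (sgn (suc r)) (bin (suc (dbl r)) (suc r))))
    altMix≡β : altMix (suc (dbl r)) ≡ β
    altMix≡β = *-cancel-suc 1 (trans (sym (altSq≡2altMix r)) altSq≡2β)

-- The coefficients of T and the reflection x ↦ 1 - x.

odd : ℕ → ℚ
odd k = 2ℚ * ι k + 1ℚ

-- At P = 0 this is C(2k,k)² / 16ᵏ; at P = 2n + 1 it is (-1)ᵏ C(n,k) C(n+k,k).
coef : ℚ → ℕ → ℚ
coef P zero    = 1ℚ
coef P (suc k) = (odd k * odd k - P * P) * coef P k * ((½ * 1/suc k) * (½ * 1/suc k))

½-cancel : ∀ k x → (2ℚ * ι (suc k)) * (2ℚ * ι (suc k)) * (x * ((½ * 1/suc k) * (½ * 1/suc k))) ≡ x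
½-cancel k x = linear₁ (x * (ι (suc k) * 1/suc k + 1ℚ)) (*-1/suc k)
  (solve 3 (λ s i x → (# 2 :* s) :* (# 2 :* s) :* (x :* ((con ½ :* i) :* (con ½ :* i))) :- x := x :* (s :* i :+ # 1)
      :* (s :* i :- # 1)) refl (ι (suc k)) (1/suc k) x)

coef-recurrence : ∀ P k → (2ℚ * ι (suc k)) * (2ℚ * ι (suc k)) * coef P (suc k) ≡ (odd k * odd k - P * P) * coef P k
coef-recurrence P k = ½-cancel k ((odd k * odd k - P * P) * coef P k)

coef-vanish : ∀ n j → coef (odd n) (suc (j ℕ.+ n)) ≡ 0ℚ
coef-vanish n zero = solve 3 (λ o c h → (o :* o :- o :* o) :* c :* h := # 0) refl (odd n) (coef (odd n) n) _
coef-vanish n (suc j) = trans (cong (λ c → (odd k * odd k - odd n * odd n) * c * h) (coef-vanish n j))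
  (solve 2 (λ a h → a :* # 0 :* h := # 0) refl (odd k * odd k - odd n * odd n) h)
  where
  k : ℕ
  k = suc (j ℕ.+ n)
  h : ℚ
  h = (½ * 1/suc k) * (½ * 1/suc k)

*-cancel-4suc² : ∀ k {x y} → (2ℚ * ι (suc k)) * (2ℚ * ι (suc k)) * x ≡ (2ℚ * ι (suc k)) * (2ℚ * ι (suc k)) * y → x ≡ y
*-cancel-4suc² k {x} {y} e = *-cancel-suc 3 (*-cancel-suc k
    (*-cancel-suc k (trans (shape x) (trans e (sym (shape y))))))
  where
  shape : ∀ z → ι (suc k) * (ι (suc k) * (ι 4 * z)) ≡ (2ℚ * ι (suc k)) * (2ℚ * ι (suc k)) * z
  shape z = solve 2 (λ s z → s :* (s :* (# 4 :* z)) := (# 2 :* s) :* (# 2 :* s) :* z) refl (ι (suc k)) z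

-- Up to sign, the coefficients of T(1 - X), where T(X) = Σₖ coef (2n+1) k Xᵏ.
reflected : ℕ → ℕ → ℚ
reflected n j = sumℚ (suc n) (λ a → coef (odd n) a * bin a j)

-- The Legendre equation is invariant under x ↦ 1 - x, so the coefficients of T(1 - X) obey the
-- recurrence of T. The minus sign is the factor (-1)ʲ left out of `reflected`.
reflected-recurrence : ∀ n j → (2ℚ * ι (suc j)) * (2ℚ * ι (suc j)) * reflected n (suc j) ≡ -
    (odd j * odd j - odd n * odd n) * reflected n j
reflected-recurrence n j = linear₁ 1ℚ telescoped
    (solve 2 (λ a b → a :- b := # 1 :* (# 1 :* a :+ (:- # 1) :* b :- # 0)) refl
    (q * reflected n (suc j)) (- (odd j * odd j - odd n * odd n) * reflected n j))
  where
  q v : ℚ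
  q = (2ℚ * ι (suc j)) * (2ℚ * ι (suc j))
  v = - (odd j * odd j - odd n * odd n)
  t : ℕ → ℚ
  t = coef (odd n)
  F X Y : ℕ → ℚ
  -- Vanishes at a = 0 by the factor a, and at a = n + 1 because T has degree n.
  F a = ι 4 * ι a * (ι a - ι j) * t a * bin a j
  X a = t a * bin a (suc j)
  Y a = t a * bin a j
  term : ∀ a → 1ℚ * (q * X a) + -1ℚ * (v * Y a) ≡ F (suc a) - F a
  term a = linear₃ (ι 4 * ι (suc j) * t a) (- (ι 4 * ι (suc a) * t (suc a))) (- bin a j) (bin-ratio a j)
      (bin-lower a j) (coef-recurrence (odd n) a)
    (solve 8 (λ a j o t t′ b b′ c → # 1 :* ((# 2 :* (1+ j)) :* (# 2 :* (1+ j)) :* (t :* b′)) :+ (:- # 1) :*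
        ((:- ((# 2 :* j :+ # 1) :* (# 2 :* j :+ # 1) :- o :* o)) :* (t :* b))
        :- (# 4 :* (1+ a) :* ((1+ a) :- j) :* t′ :* c :- # 4 :* a :* (a :- j) :* t :* b)
      := # 4 :* (1+ j) :* t :* ((1+ j) :* b′ :- (a :- j) :* b) :+ (:- (# 4 :* (1+ a) :* t′)) :*
          (((1+ a) :- j) :* c :- (1+ a) :* b)
         :+ (:- b) :* ((# 2 :* (1+ a)) :* (# 2 :* (1+ a)) :* t′ :- ((# 2 :* a :+ # 1) :* (# 2 :* a :+ # 1) :- o :* o)
             :* t))
      refl (ι a) (ι j) (odd n) (t a) (t (suc a)) (bin a j) (bin a (suc j)) (bin (suc a) j))
  telescoped : 1ℚ * (q * reflected n (suc j)) + -1ℚ * (v * reflected n j) ≡ 0ℚ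
  telescoped = begin
    1ℚ * (q * reflected n (suc j)) + -1ℚ * (v * reflected n j)
      ≡⟨ cong₂ (λ a b → 1ℚ * a + -1ℚ * b) (sum-* q (suc n) X) (sum-* v (suc n) Y) ⟨
    1ℚ * sumℚ (suc n) (λ a → q * X a) + -1ℚ * sumℚ (suc n) (λ a → v * Y a)
      ≡⟨ sum-linear 1ℚ -1ℚ (suc n) (λ a → q * X a) (λ a → v * Y a) ⟨
    sumℚ (suc n) (λ a → 1ℚ * (q * X a) + -1ℚ * (v * Y a))
      ≡⟨ sum-ext (suc n) term ⟩
    sumℚ (suc n) (λ a → F (suc a) - F a)
      ≡⟨ sum-telescope (suc n) F ⟩
    F (suc n) - F 0
      ≡⟨ cong (λ z → ι 4 * ι (suc n) * (ι (suc n) - ι j) * z * bin (suc n) j - F 0) (coef-vanish n 0) ⟩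
    ι 4 * ι (suc n) * (ι (suc n) - ι j) * 0ℚ * bin (suc n) j - F 0
      ≡⟨ solve 5 (λ s j b t b′ → # 4 :* s :* (s :- j) :* # 0 :* b :- # 4 :* # 0 :* (# 0 :- j) :* t :* b′ := # 0) refl
          (ι (suc n)) (ι j) (bin (suc n) j) (t 0) (bin 0 j) ⟩
    0ℚ ∎

-- A first-order recurrence determines the sequence up to its initial value, here T(1).
reflected-coef : ∀ n j → reflected n j ≡ reflected n 0 * (sgn j * coef (odd n) j)
reflected-coef n zero    = sym (*-identityʳ (reflected n 0))
reflected-coef n (suc j) = *-cancel-4suc² j (linear₃ 1ℚ (- (odd j * odd j - odd n * odd n)) (reflected n 0 * sgn j)
  (reflected-recurrence n j) (reflected-coef n j) (coef-recurrence (odd n) j)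
  (solve 8 (λ q v u u′ u₀ g t t′ → q :* u′ :- q :* (u₀ :* ((:- # 1) :* g :* t′)) :=
      # 1 :* (q :* u′ :- (:- v) :* u) :+ (:- v) :* (u :- u₀ :* (g :* t)) :+ u₀ :* g :* (q :* t′ :- v :* t))
    refl ((2ℚ * ι (suc j)) * (2ℚ * ι (suc j))) (odd j * odd j - odd n * odd n) (reflected n j) (reflected n (suc j))
    (reflected n 0) (sgn j) (coef (odd n) j) (coef (odd n) (suc j))))

sgn-odd : ∀ r → sgn (suc (dbl r)) ≡ -1ℚ
sgn-odd zero    = refl
sgn-odd (suc r) = trans (solve 1 (λ s → (:- # 1) :* ((:- # 1) :* s) := s) refl (sgn (suc (dbl r)))) (sgn-odd r)

reflected-top : ∀ n → reflected n n ≡ coef (odd n) n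
reflected-top n = trans (cong₂ _+_ (trans (sum-cong n (λ a a<n → trans (cong (coef (odd n) a *_) (bin-vanish a<n))
    (*-zeroʳ (coef (odd n) a)))) (sum-0 n))
    (trans (cong (λ b → coef (odd n) n * ι b) (nCn≡1 n)) (*-identityʳ (coef (odd n) n))))
  (+-identityˡ (coef (odd n) n))

-- Substituting 1 - x under a linear functional.

-- If s m is the value of a linear functional at xᵐ, this is its value at (1 - x)ᵃ xᵐ.
Δ : ℕ → (ℕ → ℚ) → ℕ → ℚ
Δ zero    s m = s m
Δ (suc a) s m = Δ a s m - Δ a s (suc m)

Δ-binomial : ∀ B a s m → a ℕ.< B → Δ a s m ≡ sumℚ B (λ j → sgn j * (bin a j * s (m ℕ.+ j)))
Δ-binomial (suc B) zero s m _ = sym (begin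
  sumℚ (suc B) (λ j → sgn j * (bin 0 j * s (m ℕ.+ j)))
    ≡⟨ sum-head B _ ⟩
  1ℚ * (1ℚ * s (m ℕ.+ 0)) + sumℚ B (λ j → sgn (suc j) * (bin 0 (suc j) * s (m ℕ.+ suc j)))
    ≡⟨ cong₂ _+_ (solve 1 (λ a → # 1 :* (# 1 :* a) := a) refl (s (m ℕ.+ 0))) (trans (sum-ext B vanish) (sum-0 B)) ⟩
  s (m ℕ.+ 0) + 0ℚ
    ≡⟨ trans (+-identityʳ (s (m ℕ.+ 0))) (cong s (ℕₚ.+-identityʳ m)) ⟩
  s m ∎)
  where
  vanish : ∀ j → sgn (suc j) * (bin 0 (suc j) * s (m ℕ.+ suc j)) ≡ 0ℚ
  vanish j = trans (cong (λ b → sgn (suc j) * (b * s (m ℕ.+ suc j))) (bin-vanish {0} {suc j} (s≤s z≤n)))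
    (solve 2 (λ a b → a :* (# 0 :* b) := # 0) refl (sgn (suc j)) (s (m ℕ.+ suc j)))
Δ-binomial (suc B) (suc a) s m (s≤s a<B) = sym (begin
  sumℚ (suc B) (λ j → sgn j * (bin (suc a) j * s (m ℕ.+ j)))
    ≡⟨ sum-head B _ ⟩
  1ℚ * (bin (suc a) 0 * s (m ℕ.+ 0)) + sumℚ B (λ j → sgn (suc j) * (bin (suc a) (suc j) * s (m ℕ.+ suc j)))
    ≡⟨ cong₂ _+_ (cong (λ b → 1ℚ * (b * s (m ℕ.+ 0))) (trans (bin-0 (suc a)) (sym (bin-0 a))))
        (trans (sum-ext B term) (sum-linear 1ℚ -1ℚ B X Y)) ⟩
  1ℚ * (bin a 0 * s (m ℕ.+ 0)) + (1ℚ * sumℚ B X + -1ℚ * sumℚ B Y)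
    ≡⟨ solve 3 (λ h x y → h :+ (# 1 :* x :+ (:- # 1) :* y) := (h :+ x) :- y) refl (1ℚ * (bin a 0 * s (m ℕ.+ 0)))
        (sumℚ B X) (sumℚ B Y) ⟩
  (1ℚ * (bin a 0 * s (m ℕ.+ 0)) + sumℚ B X) - sumℚ B Y
    ≡⟨ cong₂ _-_ (sym (trans (Δ-binomial (suc B) a s m (ℕₚ.m<n⇒m<1+n a<B)) (sum-head B _)))
        (sym (Δ-binomial B a s (suc m) a<B)) ⟩
  Δ a s m - Δ a s (suc m) ∎)
  where
  X Y : ℕ → ℚ
  X j = sgn (suc j) * (bin a (suc j) * s (m ℕ.+ suc j))
  Y j = sgn j * (bin a j * s (suc m ℕ.+ j))
  term : ∀ j → sgn (suc j) * (bin (suc a) (suc j) * s (m ℕ.+ suc j)) ≡ 1ℚ * X j + -1ℚ * Y j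
  term j rewrite ℕₚ.+-suc m j | bin-pascal a j =
    solve 4 (λ g b c z → ((:- # 1) :* g) :* ((b :+ c) :* z) := # 1 :* (((:- # 1) :* g) :* (c :* z)) :+ (:- # 1) :*
        (g :* (b :* z)))
      refl (sgn j) (bin a j) (bin a (suc j)) (s (suc (m ℕ.+ j)))

-- Expanding the differences and exchanging the sums produces the coefficients of T(1 - X). Keeping
-- the functional s arbitrary lets one lemma serve evaluation, differentiation and integration.
Δ-antisymmetric : ∀ n → reflected n 0 ≡ -1ℚ → ∀ s m →
  sumℚ (suc n) (λ a → coef (odd n) a * Δ a s m) ≡ - sumℚ (suc n) (λ j → coef (odd n) j * s (m ℕ.+ j))
Δ-antisymmetric n u₀ s m = begin
  sumℚ (suc n) (λ a → t a * Δ a s m)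
    ≡⟨ sum-cong (suc n) (λ a a<1+n → trans (cong (t a *_) (Δ-binomial (suc n) a s m a<1+n))
        (sym (sum-* (t a) (suc n) _))) ⟩
  sumℚ (suc n) (λ a → sumℚ (suc n) (λ j → t a * (sgn j * (bin a j * s (m ℕ.+ j)))))
    ≡⟨ sum-swap (suc n) (suc n) _ ⟩
  sumℚ (suc n) (λ j → sumℚ (suc n) (λ a → t a * (sgn j * (bin a j * s (m ℕ.+ j)))))
    ≡⟨ sum-ext (suc n) inner ⟩
  sumℚ (suc n) (λ j → -1ℚ * (t j * s (m ℕ.+ j)))
    ≡⟨ sum-* -1ℚ (suc n) _ ⟩
  -1ℚ * sumℚ (suc n) (λ j → t j * s (m ℕ.+ j))
    ≡⟨ solve 1 (λ a → (:- # 1) :* a := :- a) refl (sumℚ (suc n) (λ j → t j * s (m ℕ.+ j))) ⟩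
  - sumℚ (suc n) (λ j → t j * s (m ℕ.+ j)) ∎
  where
  t : ℕ → ℚ
  t = coef (odd n)
  inner : ∀ j → sumℚ (suc n) (λ a → t a * (sgn j * (bin a j * s (m ℕ.+ j)))) ≡ -1ℚ * (t j * s (m ℕ.+ j))
  inner j = begin
    sumℚ (suc n) (λ a → t a * (sgn j * (bin a j * z)))
      ≡⟨ sum-ext (suc n) (λ a → solve 4 (λ t g b z → t :* (g :* (b :* z)) := (g :* z) :* (t :* b)) refl (t a) (sgn j)
          (bin a j) z) ⟩
    sumℚ (suc n) (λ a → (sgn j * z) * (t a * bin a j))
      ≡⟨ sum-* (sgn j * z) (suc n) _ ⟩
    (sgn j * z) * reflected n j
      ≡⟨ linear₃ (sgn j * z) (sgn j * z * (sgn j * t j)) (-1ℚ * z * t j) (reflected-coef n j) u₀ (sgn-sq j)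
           (solve 5 (λ g z t u u₀ → (g :* z) :* u :- (:- # 1) :* (t :* z) := g :* z :* (u :- u₀ :* (g :* t)) :+ g :*
               z :* (g :* t) :* (u₀ :- (:- # 1)) :+ (:- # 1) :* z :* t :* (g :* g :- # 1))
             refl (sgn j) z (t j) (reflected n j) (reflected n 0)) ⟩
    -1ℚ * (t j * z) ∎
    where
    z : ℚ
    z = s (m ℕ.+ j)

-- Integration along the path and evaluation at -1.

pow2 : ℕ → ℚ
pow2 = 2ℚ ^^_

-- moment m = ∫ xᵐ dx taken over [0,-1] + [0,2] - [0,1].
endpoints moment : ℕ → ℚ
endpoints m = pow2 m + sgn m - 1ℚ
moment m = endpoints (suc m) * 1/suc m

suc*moment : ∀ m → ι (suc m) * moment m ≡ endpoints (suc m)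
suc*moment m = linear₁ (endpoints (suc m)) (*-1/suc m)
  (solve 3 (λ s e i → s :* (e :* i) :- e := e :* (s :* i :- # 1)) refl (ι (suc m)) (endpoints (suc m)) (1/suc m))

-- Integration by parts: Δ a moment b is the integral of (1 - x)ᵃ xᵇ.
moment-parts : ∀ a b → ι (suc b) * Δ (suc a) moment b ≡
  ι (suc a) * Δ a moment (suc b) + (pow2 (suc a) * sgn (suc b) + sgn (suc a) * pow2 (suc b))
moment-parts zero b = linear₂ 1ℚ -1ℚ (suc*moment b) (suc*moment (suc b))
  (solve 5 (λ b x g s s′ → (1+ b) :* (s :- s′) :- (# 1 :* s′ :+ (# 2 :* # 1 :* ((:- # 1) :* g) :+ (:- # 1) :* # 1 :*
      (# 2 :* x))) :=
      # 1 :* ((1+ b) :* s :- (# 2 :* x :+ (:- # 1) :* g :- # 1)) :+ (:- # 1) :*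
          ((1+ 1+ b) :* s′ :- (# 2 :* (# 2 :* x) :+ (:- # 1) :* ((:- # 1) :* g) :- # 1)))
    refl (ι b) (pow2 b) (sgn b) (moment b) (moment (suc b)))
moment-parts (suc a) b = linear₂ 1ℚ -1ℚ (moment-parts a b) (moment-parts a (suc b))
  (solve 9 (λ a b x g y h u v w →
      (1+ b) :* ((u :- v) :- (v :- w)) :- ((1+ 1+ a) :* (v :- w) :+ (# 2 :* (# 2 :* x) :* ((:- # 1) :* h) :+ (:- # 1)
          :* ((:- # 1) :* g) :* (# 2 :* y))) :=
      # 1 :* ((1+ b) :* (u :- v) :- ((1+ a) :* v :+ (# 2 :* x :* ((:- # 1) :* h) :+ (:- # 1) :* g :* (# 2 :* y))))
      :+ (:- # 1) :* ((1+ 1+ b) :* (v :- w) :- ((1+ a) :* w :+ (# 2 :* x :* ((:- # 1) :* ((:- # 1) :* h)) :+ (:- # 1)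
          :* g :* (# 2 :* (# 2 :* y))))))
    refl (ι a) (ι b) (pow2 a) (sgn a) (pow2 b) (sgn b) (Δ a moment b) (Δ a moment (suc b)) (Δ a moment (suc (suc b))))

moment-reflect₀ : ∀ a → ι (suc a) * Δ a moment 0 ≡ - endpoints (suc a)
moment-reflect₀ zero    = refl
moment-reflect₀ (suc a) = linear₂ 1ℚ 1ℚ (moment-parts a 0) (moment-reflect₀ a)
  (solve 5 (λ a x g u v → (1+ 1+ a) :* (u :- v) :- (:- (# 2 :* (# 2 :* x) :+ (:- # 1) :* ((:- # 1) :* g) :- # 1)) :=
      # 1 :* (# 1 :* (u :- v) :- ((1+ a) :* v :+ (# 2 :* x :* ((:- # 1) :* # 1) :+ (:- # 1) :* g :* (# 2 :* # 1))))
      :+ # 1 :* ((1+ a) :* u :- (:- (# 2 :* x :+ (:- # 1) :* g :- # 1))))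
    refl (ι a) (pow2 a) (sgn a) (Δ a moment 0) (Δ a moment 1))

-- Under x ↦ 1 - x the ends -1 and 2 are exchanged, as are 0 and 1, while dx changes sign. The
-- induction on a starts from pure powers of 1 - x.
moment-reflect : ∀ a b → Δ a moment b ≡ - Δ b moment a
moment-reflect zero    b = *-cancel-suc b (trans (suc*moment b) (linear₁ 1ℚ (moment-reflect₀ b)
  (solve 3 (λ s d e → e :- s :* (:- d) := # 1 :* (s :* d :- (:- e))) refl (ι (suc b)) (Δ b moment 0)
      (endpoints (suc b)))))
moment-reflect (suc a) b = linear₂ 1ℚ -1ℚ (moment-reflect a b) (moment-reflect a (suc b))
  (solve 4 (λ u v w z → (u :- v) :- (:- z) := # 1 :* (u :- (:- w)) :+ (:- # 1) :* (v :- (:- (w :- z)))) refl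
    (Δ a moment b) (Δ a moment (suc b)) (Δ b moment a) (Δ b moment (suc a)))

-- `sgn` is evaluation at -1, where 1 - x is 2.
Δ-sgn : ∀ a m → Δ a sgn m ≡ pow2 a * sgn m
Δ-sgn zero    m = sym (*-identityˡ (sgn m))
Δ-sgn (suc a) m = trans (cong₂ _-_ (Δ-sgn a m) (Δ-sgn a (suc m)))
  (solve 2 (λ x g → x :* g :- x :* ((:- # 1) :* g) := # 2 :* x :* g) refl (pow2 a) (sgn m))

-- The functional is x d/dx followed by evaluation at -1; the factor 2 avoids the exponent a - 1.
Δ-ιsgn : ∀ a m → 2ℚ * Δ a (λ k → ι k * sgn k) m ≡ pow2 a * sgn m * (2ℚ * ι m + ι a)
Δ-ιsgn zero    m = solve 2 (λ m g → # 2 :* (m :* g) := # 1 :* g :* (# 2 :* m :+ # 0)) refl (ι m) (sgn m)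
Δ-ιsgn (suc a) m = linear₂ 1ℚ -1ℚ (Δ-ιsgn a m) (Δ-ιsgn a (suc m))
  (solve 6 (λ a m x g u v → # 2 :* (u :- v) :- # 2 :* x :* g :* (# 2 :* m :+ (1+ a)) :=
     # 1 :* (# 2 :* u :- x :* g :* (# 2 :* m :+ a)) :+ (:- # 1) :* (# 2 :* v :- x :* ((:- # 1) :* g) :*
         (# 2 :* (1+ m) :+ a)))
    refl (ι a) (ι m) (pow2 a) (sgn m) (Δ a (λ k → ι k * sgn k) m) (Δ a (λ k → ι k * sgn k) (suc m)))

-- The integrals of xʲ T and their recurrence.

module Legendre (n : ℕ) (u₀ : reflected n 0 ≡ -1ℚ) where

  t : ℕ → ℚ
  t = coef (odd n)

  N : ℕ
  N = suc n

  -- In terms of T these are T(-1), -T′(-1), T(2) and 2 T′(2).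
  τ θ τ₂ θ₂ : ℚ
  τ  = sumℚ N (λ k → t k * sgn k)
  θ  = sumℚ N (λ k → t k * (ι k * sgn k))
  τ₂ = sumℚ N (λ k → t k * pow2 k)
  θ₂ = sumℚ N (λ k → t k * (ι k * pow2 k))

  τ₂≡-τ : τ₂ ≡ - τ
  τ₂≡-τ = trans (sum-ext N (λ k → cong (t k *_) (sym (trans (Δ-sgn k 0) (*-identityʳ (pow2 k))))))
      (Δ-antisymmetric n u₀ sgn 0)

  θ₂≡-2θ : θ₂ ≡ - 2ℚ * θ
  θ₂≡-2θ = begin
    θ₂
      ≡⟨ sum-ext N (λ k → trans (cong (t k *_) (trans (solve 2 (λ a x → a :* x := x :* # 1 :* (# 2 :* # 0 :+ a)) refl
          (ι k) (pow2 k)) (sym (Δ-ιsgn k 0))))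
           (solve 2 (λ a b → a :* (# 2 :* b) := # 2 :* (a :* b)) refl (t k) (Δ k s 0))) ⟩
    sumℚ N (λ k → 2ℚ * (t k * Δ k s 0))
      ≡⟨ sum-* 2ℚ N _ ⟩
    2ℚ * sumℚ N (λ k → t k * Δ k s 0)
      ≡⟨ cong (2ℚ *_) (Δ-antisymmetric n u₀ s 0) ⟩
    2ℚ * - θ
      ≡⟨ solve 1 (λ a → # 2 :* (:- a) := (:- # 2) :* a) refl θ ⟩
    - 2ℚ * θ ∎
    where
    s : ℕ → ℚ
    s k = ι k * sgn k

  Λ : ℕ → ℚ
  Λ j = sumℚ N (λ k → t k * moment (j ℕ.+ k))

  -- The integrand T² is invariant under x ↦ 1 - x, which reverses the path of integration.
  Λ-self : sumℚ N (λ j → t j * Λ j) ≡ 0ℚ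
  Λ-self = linear₁ ½ self-negative (solve 1 (λ a → a :- # 0 := con ½ :* (a :- :- a)) refl total)
    where
    total : ℚ
    total = sumℚ N (λ j → t j * Λ j)
    Λ-reflect : ∀ j → Λ j ≡ sumℚ N (λ k → t k * Δ j moment k)
    Λ-reflect j = begin
      Λ j
        ≡⟨ solve 1 (λ a → a := (:- # 1) :* (:- a)) refl (Λ j) ⟩
      -1ℚ * - Λ j
        ≡⟨ cong (-1ℚ *_) (Δ-antisymmetric n u₀ moment j) ⟨
      -1ℚ * sumℚ N (λ k → t k * Δ k moment j)
        ≡⟨ sum-* -1ℚ N _ ⟨
      sumℚ N (λ k → -1ℚ * (t k * Δ k moment j))
        ≡⟨ sum-ext N (λ k → linear₁ (- t k) (moment-reflect j k) (solve 3 (λ t a b → (:- # 1) :* (t :* a) :- t :* b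
            := (:- t) :* (b :- :- a)) refl (t k) (Δ k moment j) (Δ j moment k))) ⟩
      sumℚ N (λ k → t k * Δ j moment k) ∎
    self-negative : total ≡ - total
    self-negative = begin
      total
        ≡⟨ sum-ext N (λ j → trans (cong (t j *_) (Λ-reflect j)) (sym (sum-* (t j) N _))) ⟩
      sumℚ N (λ j → sumℚ N (λ k → t j * (t k * Δ j moment k)))
        ≡⟨ sum-swap N N _ ⟩
      sumℚ N (λ k → sumℚ N (λ j → t j * (t k * Δ j moment k)))
        ≡⟨ sum-ext N (λ k → trans (sum-ext N (λ j → solve 3 (λ a b c → a :* (b :* c) := b :* (a :* c)) refl (t j)
            (t k) (Δ j moment k)))
             (trans (sum-* (t k) N _) (cong (t k *_) (Δ-antisymmetric n u₀ moment k)))) ⟩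
      sumℚ N (λ k → t k * - Λ k)
        ≡⟨ sum-ext N (λ k → solve 2 (λ a b → a :* (:- b) := (:- # 1) :* (a :* b)) refl (t k) (Λ k)) ⟩
      sumℚ N (λ k → -1ℚ * (t k * Λ k))
        ≡⟨ sum-* -1ℚ N _ ⟩
      -1ℚ * total
        ≡⟨ solve 1 (λ a → (:- # 1) :* a := :- a) refl total ⟩
      - total ∎

  -- The first two terms are the values of -4x(1 - x)(T′ xᵐ - m T x^(m-1)) at -1 and 2, where x(1 -
  -- x) = -2, with T(2) and T′(2) rewritten by reflection. The last comes from the eigenvalue,
  -- 4n(n+1) = (2n+1)² - 1.
  boundary : ℕ → ℚ
  boundary m = - ι 8 * θ * (pow2 m + sgn m) + ι 4 * ι m * τ * (pow2 m + 2ℚ * sgn m) - odd n * odd n * Λ m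

  -- Two integrations by parts move the Legendre operator from T onto xᵐ with m = k + 1, which it
  -- sends to a combination of x^(m-1) and xᵐ.
  Λ-recurrence : ∀ k → (2ℚ * ι (suc k)) * (2ℚ * ι (suc k)) * Λ k - odd (suc k) * odd (suc k) * Λ (suc k) ≡ boundary
      (suc k)
  Λ-recurrence k = begin
    q * Λ k - q′ * Λ m
      ≡⟨ solve 4 (λ q a q′ b → q :* a :- q′ :* b := q :* a :+ (:- q′) :* b) refl q (Λ k) q′ (Λ m) ⟩
    q * Λ k + - q′ * Λ m
      ≡⟨ sum-linear q (- q′) N (λ i → t i * moment (k ℕ.+ i)) (λ i → t i * moment (m ℕ.+ i)) ⟨
    sumℚ N (λ i → q * (t i * moment (k ℕ.+ i)) + - q′ * (t i * moment (m ℕ.+ i)))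
      ≡⟨ sum-ext N term ⟩
    sumℚ N (λ i → (c₁ * X₁ i + c₂ * X₂ i) + ((c₃ * X₃ i + c₄ * X₄ i) + (c₅ * X₅ i + -1ℚ * (F (suc i) - F i))))
      ≡⟨ trans (sum-+ N _ _) (cong₂ _+_ (sum-linear c₁ c₂ N X₁ X₂)
           (trans (sum-+ N _ _) (cong₂ _+_ (sum-linear c₃ c₄ N X₃ X₄)
             (trans (sum-linear c₅ -1ℚ N X₅ _) (cong (λ a → c₅ * Λ m + -1ℚ * a) (sum-telescope N F)))))) ⟩
    (c₁ * τ + c₂ * θ) + ((c₃ * τ₂ + c₄ * θ₂) + (c₅ * Λ m + -1ℚ * (F N - F 0)))
      ≡⟨ cong (λ z → (c₁ * τ + c₂ * θ) + ((c₃ * τ₂ + c₄ * θ₂) + (c₅ * Λ m + -1ℚ * (z - F 0)))) F-top ⟩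
    (c₁ * τ + c₂ * θ) + ((c₃ * τ₂ + c₄ * θ₂) + (c₅ * Λ m + -1ℚ * (0ℚ - F 0)))
      ≡⟨ linear₂ c₃ c₄ τ₂≡-τ θ₂≡-2θ
           (solve 11 (λ m x g τ θ τ₂ θ₂ p L t s →
              (# 8 :* m :* g :* τ :+ (:- # 8) :* g :* θ) :+ (((:- # 4) :* m :* x :* τ₂ :+ # 4 :* x :* θ₂) :+
                  ((:- (p :* p)) :* L :+ (:- # 1) :* (# 0 :- # 4 :* (# 0 :* # 0) :* t :* s)))
                :- ((:- # 8) :* θ :* (x :+ g) :+ # 4 :* m :* τ :* (x :+ # 2 :* g) :- p :* p :* L)
              := (:- # 4) :* m :* x :* (τ₂ :- (:- τ)) :+ # 4 :* x :* (θ₂ :- (:- # 2) :* θ))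
             refl (ι m) (pow2 m) (sgn m) τ θ τ₂ θ₂ (odd n) (Λ m) (t 0) (moment (k ℕ.+ 0))) ⟩
    boundary m ∎
    where
    m : ℕ
    m = suc k
    q q′ c₁ c₂ c₃ c₄ c₅ : ℚ
    q  = (2ℚ * ι m) * (2ℚ * ι m)
    q′ = odd m * odd m
    c₁ = ι 8 * ι m * sgn m
    c₂ = - ι 8 * sgn m
    c₃ = - ι 4 * ι m * pow2 m
    c₄ = ι 4 * pow2 m
    c₅ = - (odd n * odd n)
    X₁ X₂ X₃ X₄ X₅ F : ℕ → ℚ
    X₁ i = t i * sgn i
    X₂ i = t i * (ι i * sgn i)
    X₃ i = t i * pow2 i
    X₄ i = t i * (ι i * pow2 i)
    X₅ i = t i * moment (m ℕ.+ i)
    -- Telescoping in i is how the coefficient recurrence, that is, the differential equation of T,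
    -- enters.
    F i = ι 4 * (ι i * ι i) * t i * moment (k ℕ.+ i)
    F-top : F N ≡ 0ℚ
    F-top = trans (cong (λ z → ι 4 * (ι N * ι N) * z * moment (k ℕ.+ N)) (coef-vanish n 0))
      (solve 2 (λ a b → # 4 :* (a :* a) :* # 0 :* b := # 0) refl (ι N) (moment (k ℕ.+ N)))
    lower : ∀ i → (ι m + ι i) * moment (k ℕ.+ i) ≡ pow2 m * pow2 i + sgn m * sgn i - 1ℚ
    lower i = begin
      (ι m + ι i) * moment (k ℕ.+ i)          ≡⟨ cong (_* moment (k ℕ.+ i)) (ι-+ m i) ⟨
      ι (m ℕ.+ i) * moment (k ℕ.+ i)          ≡⟨ suc*moment (k ℕ.+ i) ⟩
      pow2 (m ℕ.+ i) + sgn (m ℕ.+ i) - 1ℚ     ≡⟨ cong₂ (λ a b → a + b - 1ℚ) (^-homo-* 2ℚ m i) (^-homo-* -1ℚ m i) ⟩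
      pow2 m * pow2 i + sgn m * sgn i - 1ℚ    ∎
    upper : ∀ i → (1ℚ + (ι m + ι i)) * moment (m ℕ.+ i) ≡ 2ℚ * (pow2 m * pow2 i) + -1ℚ * (sgn m * sgn i) - 1ℚ
    upper i = begin
      (1ℚ + (ι m + ι i)) * moment (m ℕ.+ i)   ≡⟨ cong (λ a → (1ℚ + a) * moment (m ℕ.+ i)) (ι-+ m i) ⟨
      ι (suc (m ℕ.+ i)) * moment (m ℕ.+ i)    ≡⟨ suc*moment (m ℕ.+ i) ⟩
      2ℚ * pow2 (m ℕ.+ i) + -1ℚ * sgn (m ℕ.+ i) - 1ℚ ≡⟨ cong₂ (λ a b → 2ℚ * a + -1ℚ * b - 1ℚ) (^-homo-* 2ℚ m i)
          (^-homo-* -1ℚ m i) ⟩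
      2ℚ * (pow2 m * pow2 i) + -1ℚ * (sgn m * sgn i) - 1ℚ ∎
    term : ∀ i → q * (t i * moment (k ℕ.+ i)) + - q′ * X₅ i
      ≡ (c₁ * X₁ i + c₂ * X₂ i) + ((c₃ * X₃ i + c₄ * X₄ i) + (c₅ * X₅ i + -1ℚ * (F (suc i) - F i)))
    term i rewrite ℕₚ.+-suc k i = linear₃ (ι 4 * t i * (ι m - ι i)) (- ι 4 * t i * (ι m - ι i)) (moment (m ℕ.+ i))
        (lower i) (upper i) (coef-recurrence (odd n) i)
      (solve 11 (λ m i p t t′ a a′ x g y h →
         (# 2 :* m) :* (# 2 :* m) :* (t :* a) :+ (:- ((# 2 :* m :+ # 1) :* (# 2 :* m :+ # 1))) :* (t :* a′)
           :- ((# 8 :* m :* g :* (t :* h) :+ (:- # 8) :* g :* (t :* (i :* h))) :+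
               (((:- # 4) :* m :* x :* (t :* y) :+ # 4 :* x :* (t :* (i :* y)))
               :+ ((:- (p :* p)) :* (t :* a′) :+ (:- # 1) :* (# 4 :* ((1+ i) :* (1+ i)) :* t′ :* a′ :- # 4 :*
                   (i :* i) :* t :* a))))
         := # 4 :* t :* (m :- i) :* ((m :+ i) :* a :- (x :* y :+ g :* h :- # 1))
            :+ (:- # 4) :* t :* (m :- i) :* ((# 1 :+ (m :+ i)) :* a′ :- (# 2 :* (x :* y) :+ (:- # 1) :* (g :* h) :- #
                1))
            :+ a′ :* ((# 2 :* (1+ i)) :* (# 2 :* (1+ i)) :* t′ :- ((# 2 :* i :+ # 1) :* (# 2 :* i :+ # 1) :- p :* p)
                :* t))
        refl (ι m) (ι i) (odd n) (t i) (t (suc i)) (moment (k ℕ.+ i)) (moment (m ℕ.+ i)) (pow2 m) (sgn m) (pow2 i)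
            (sgn i))

-- The deformation from P = 0 to P = p.

-- The coefficients of G. Defining them by recurrence rather than by dividing by P² shows that only
-- the factors 4(k+1)² enter as denominators.
deform : ℚ → ℕ → ℚ
deform P zero    = 0ℚ
deform P (suc k) = (odd k * odd k * deform P k + coef P k) * ((½ * 1/suc k) * (½ * 1/suc k))

coef-deform : ∀ P k → coef 0ℚ k ≡ coef P k + P * P * deform P k
coef-deform P zero    = solve 1 (λ p → # 1 := # 1 :+ p :* p :* # 0) refl P
coef-deform P (suc k) = trans (cong (λ c → (odd k * odd k - 0ℚ * 0ℚ) * c * h) (coef-deform P k))
  (solve 5 (λ p o c g h → (o :* o :- # 0 :* # 0) :* (c :+ p :* p :* g) :* h := (o :* o :- p :* p) :* c :* h :+ p :* p
      :* ((o :* o :* g :+ c) :* h))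
    refl P (odd k) (coef P k) (deform P k) h)
  where
  h : ℚ
  h = (½ * 1/suc k) * (½ * 1/suc k)

-- Summation by parts, from (2k+2)² `deform P (suc k)` - (2k+1)² `deform P k` = `coef P k`. The
-- operator falling on L is the one that `Λ-recurrence` evaluates.
deform-pairing : ∀ P (L : ℕ → ℚ) K → sumℚ K (λ k → coef P k * L k) ≡
  odd K * odd K * deform P K * L K +
  sumℚ K (λ k → deform P (suc k) * ((2ℚ * ι (suc k)) * (2ℚ * ι (suc k)) * L k - odd (suc k) * odd (suc k) * L
      (suc k)))
deform-pairing P L zero    = sym (solve 1 (λ l → (# 2 :* # 0 :+ # 1) :* (# 2 :* # 0 :+ # 1) :* # 0 :* l :+ # 0 := #
    0) refl (L 0))
deform-pairing P L (suc K) = linear₂ 1ℚ (- L K) (deform-pairing P L K)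
    (½-cancel K (odd K * odd K * deform P K + coef P K))
  (solve 10 (λ s s′ o o′ q c g g′ l l′ → s :+ c :* l :- (o′ :* o′ :* g′ :* l′ :+
      (s′ :+ g′ :* (q :* l :- o′ :* o′ :* l′))) :=
      # 1 :* (s :- (o :* o :* g :* l :+ s′)) :+ (:- l) :* (q :* g′ :- (o :* o :* g :+ c)))
    refl (sumℚ K (λ k → coef P k * L k)) (sumℚ K (λ k → deform P (suc k) * ((2ℚ * ι (suc k)) * (2ℚ * ι (suc k)) * L k
        - odd (suc k) * odd (suc k) * L (suc k))))
      (odd K) (odd (suc K)) ((2ℚ * ι (suc K)) * (2ℚ * ι (suc K))) (coef P K) (deform P K) (deform P (suc K)) (L K)
          (L (suc K)))

-- The ring of p-integral rationals and congruence modulo p.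

ι-injective : ∀ {m n} → ι m ≡ ι n → m ≡ n
ι-injective {zero}  {zero}  e = refl
ι-injective {zero}  {suc n} e = contradiction e (<⇒≢ (0<ι-suc n))
ι-injective {suc m} {zero}  e = contradiction (sym e) (<⇒≢ (0<ι-suc m))
ι-injective {suc m} {suc n} e = cong suc (ι-injective
    (linear₁ 1ℚ e (solve 2 (λ m n → m :- n := # 1 :* ((1+ m) :- (1+ n))) refl (ι m) (ι n))))

module Local (p : ℕ) (p-prime : Prime p) where

  infix 4 _≈_

  -- x ∈ ℤ₍ₚ₎, witnessed by d x = a - b with p ∤ d.
  record Integral (x : ℚ) : Set where
    constructor integral
    field
      {d a b}  : ℕ
      p∤d      : p ∤ d
      equation : ι d * x + ι b ≡ ι a

  record _≈_ (x y : ℚ) : Set where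
    constructor by
    field
      {quot}        : ℚ
      quot-integral : Integral quot
      equation      : x ≡ y + ι p * quot

  p∤1 : p ∤ 1
  p∤1 = >⇒∤ (ℕ.nonTrivial⇒n>1 p)
    where instance _ = prime⇒nonTrivial p-prime

  p∤* : ∀ {m n} → p ∤ m → p ∤ n → p ∤ m ℕ.* n
  p∤* {m} {n} p∤m p∤n p∣mn = [ p∤m , p∤n ]′ (euclidsLemma m n p-prime p∣mn)

  Integral-ι : ∀ n → Integral (ι n)
  Integral-ι n = integral {a = n} {b = 0} p∤1 (solve 1 (λ n → # 1 :* n :+ # 0 := n) refl (ι n))

  Integral-1/suc : ∀ {k} → p ∤ suc k → Integral (1/suc k)
  Integral-1/suc {k} p∤ = integral {a = 1} {b = 0} p∤ (trans (+-identityʳ _) (*-1/suc k))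

  Integral-+ : ∀ {x y} → Integral x → Integral y → Integral (x + y)
  Integral-+ {x} {y} (integral {d} {a} {b} p∤d e) (integral {d′} {a′} {b′} p∤d′ e′) =
    integral {d = d ℕ.* d′} {a ℕ.* d′ ℕ.+ a′ ℕ.* d} {b ℕ.* d′ ℕ.+ b′ ℕ.* d} (p∤* p∤d p∤d′) (begin
      ι (d ℕ.* d′) * (x + y) + ι (b ℕ.* d′ ℕ.+ b′ ℕ.* d)
        ≡⟨ cong₂ (λ u v → u * (x + y) + v) (ι-* d d′) (trans (ι-+ (b ℕ.* d′) (b′ ℕ.* d))
            (cong₂ _+_ (ι-* b d′) (ι-* b′ d))) ⟩
      ι d * ι d′ * (x + y) + (ι b * ι d′ + ι b′ * ι d)
        ≡⟨ linear₂ (ι d′) (ι d) e e′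
             (solve 8 (λ x y d a b d′ a′ b′ → d :* d′ :* (x :+ y) :+ (b :* d′ :+ b′ :* d) :- (a :* d′ :+ a′ :* d) :=
                d′ :* (d :* x :+ b :- a) :+ d :* (d′ :* y :+ b′ :- a′)) refl x y (ι d) (ι a) (ι b) (ι d′) (ι a′)
                    (ι b′)) ⟩
      ι a * ι d′ + ι a′ * ι d
        ≡⟨ trans (ι-+ (a ℕ.* d′) (a′ ℕ.* d)) (cong₂ _+_ (ι-* a d′) (ι-* a′ d)) ⟨
      ι (a ℕ.* d′ ℕ.+ a′ ℕ.* d) ∎)

  Integral-* : ∀ {x y} → Integral x → Integral y → Integral (x * y)
  Integral-* {x} {y} (integral {d} {a} {b} p∤d e) (integral {d′} {a′} {b′} p∤d′ e′) =
    integral {d = d ℕ.* d′} {a ℕ.* a′ ℕ.+ b ℕ.* b′} {a ℕ.* b′ ℕ.+ b ℕ.* a′} (p∤* p∤d p∤d′) (begin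
      ι (d ℕ.* d′) * (x * y) + ι (a ℕ.* b′ ℕ.+ b ℕ.* a′)
        ≡⟨ cong₂ (λ u v → u * (x * y) + v) (ι-* d d′) (trans (ι-+ (a ℕ.* b′) (b ℕ.* a′))
            (cong₂ _+_ (ι-* a b′) (ι-* b a′))) ⟩
      ι d * ι d′ * (x * y) + (ι a * ι b′ + ι b * ι a′)
        ≡⟨ linear₂ (ι d′ * y) (ι a - ι b) e e′
             (solve 8 (λ x y d a b d′ a′ b′ → d :* d′ :* (x :* y) :+ (a :* b′ :+ b :* a′) :- (a :* a′ :+ b :* b′) :=
                d′ :* y :* (d :* x :+ b :- a) :+ (a :- b) :* (d′ :* y :+ b′ :- a′)) refl x y (ι d) (ι a) (ι b) (ι d′)
                    (ι a′) (ι b′)) ⟩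
      ι a * ι a′ + ι b * ι b′
        ≡⟨ trans (ι-+ (a ℕ.* a′) (b ℕ.* b′)) (cong₂ _+_ (ι-* a a′) (ι-* b b′)) ⟨
      ι (a ℕ.* a′ ℕ.+ b ℕ.* b′) ∎)

  Integral-neg : ∀ {x} → Integral x → Integral (- x)
  Integral-neg {x} (integral {d} {a} {b} p∤d e) = integral {a = b} {b = a} p∤d (linear₁ -1ℚ e
    (solve 4 (λ d x a b → d :* (:- x) :+ a :- b := (:- # 1) :* (d :* x :+ b :- a)) refl (ι d) x (ι a) (ι b)))

  Integral-minus : ∀ {x y} → Integral x → Integral y → Integral (x - y)
  Integral-minus X Y = Integral-+ X (Integral-neg Y)

  Integral-sum : ∀ N {f} → (∀ k → k ℕ.< N → Integral (f k)) → Integral (sumℚ N f)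
  Integral-sum zero    h = Integral-ι 0
  Integral-sum (suc N) h = Integral-+ (Integral-sum N (λ k k<N → h k (ℕₚ.m<n⇒m<1+n k<N))) (h N ℕₚ.≤-refl)

  Integral-^ : ∀ {x} k → Integral x → Integral (x ^^ k)
  Integral-^ zero    X = Integral-ι 1
  Integral-^ (suc k) X = Integral-* X (Integral-^ k X)

  Integral-pow2 : ∀ k → Integral (pow2 k)
  Integral-pow2 k = Integral-^ k (Integral-ι 2)

  Integral-sgn : ∀ k → Integral (sgn k)
  Integral-sgn k = Integral-^ k (Integral-neg (Integral-ι 1))

  Integral-bin : ∀ n k → Integral (bin n k)
  Integral-bin n k = Integral-ι (n C k)

  ≡⇒≈ : ∀ {x y} → x ≡ y → x ≈ y
  ≡⇒≈ {x} refl = by (Integral-ι 0) (solve 2 (λ x p → x := x :+ p :* # 0) refl x (ι p))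

  ≈-refl : ∀ {x} → x ≈ x
  ≈-refl = ≡⇒≈ refl

  ≈-sym : ∀ {x y} → x ≈ y → y ≈ x
  ≈-sym {x} {y} (by {z} Z e) = by (Integral-neg Z) (linear₁ -1ℚ e
    (solve 4 (λ x y p z → y :- (x :+ p :* (:- z)) := (:- # 1) :* (x :- (y :+ p :* z))) refl x y (ι p) z))

  ≈-trans : ∀ {x y z} → x ≈ y → y ≈ z → x ≈ z
  ≈-trans {x} {y} {z} (by {u} U e) (by {v} V e′) = by (Integral-+ U V) (linear₂ 1ℚ 1ℚ e e′
    (solve 6 (λ x y z p u v → x :- (z :+ p :* (u :+ v)) := # 1 :* (x :- (y :+ p :* u)) :+ # 1 :*
        (y :- (z :+ p :* v))) refl x y z (ι p) u v))

  ≈-+ : ∀ {x y x′ y′} → x ≈ x′ → y ≈ y′ → x + y ≈ x′ + y′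
  ≈-+ {x} {y} {x′} {y′} (by {u} U e) (by {v} V e′) = by (Integral-+ U V) (linear₂ 1ℚ 1ℚ e e′
    (solve 7 (λ x x′ y y′ p u v → (x :+ y) :- ((x′ :+ y′) :+ p :* (u :+ v)) := # 1 :* (x :- (x′ :+ p :* u)) :+ # 1 :*
        (y :- (y′ :+ p :* v)))
      refl x x′ y y′ (ι p) u v))

  ≈-*ˡ : ∀ {c x y} → Integral c → x ≈ y → c * x ≈ c * y
  ≈-*ˡ {c} {x} {y} C₀ (by {z} Z e) = by (Integral-* C₀ Z) (linear₁ c e
    (solve 5 (λ c x y p z → c :* x :- (c :* y :+ p :* (c :* z)) := c :* (x :- (y :+ p :* z))) refl c x y (ι p) z))

  ≈-*ʳ : ∀ {c x y} → Integral c → x ≈ y → x * c ≈ y * c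
  ≈-*ʳ {c} {x} {y} C₀ e = subst₂ _≈_ (*-comm c x) (*-comm c y) (≈-*ˡ C₀ e)

  ≈-neg : ∀ {x y} → x ≈ y → - x ≈ - y
  ≈-neg {x} {y} (by {z} Z e) = by (Integral-neg Z) (linear₁ -1ℚ e
    (solve 4 (λ x y p z → (:- x) :- ((:- y) :+ p :* (:- z)) := (:- # 1) :* (x :- (y :+ p :* z))) refl x y (ι p) z))

  ≈-minus : ∀ {x y x′ y′} → x ≈ x′ → y ≈ y′ → x - y ≈ x′ - y′
  ≈-minus e e′ = ≈-+ e (≈-neg e′)

  ≈-sum : ∀ N {f g} → (∀ k → k ℕ.< N → f k ≈ g k) → sumℚ N f ≈ sumℚ N g
  ≈-sum zero    h = ≈-refl
  ≈-sum (suc N) h = ≈-+ (≈-sum N (λ k k<N → h k (ℕₚ.m<n⇒m<1+n k<N))) (h N ℕₚ.≤-refl)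

  ≈-Integral : ∀ {x y} → Integral y → x ≈ y → Integral x
  ≈-Integral Y (by Z e) = subst Integral (sym e) (Integral-+ Y (Integral-* (Integral-ι p) Z))

  p*≈0 : ∀ {x} → Integral x → ι p * x ≈ 0ℚ
  p*≈0 X = by X (sym (+-identityˡ _))

  *≈0 : ∀ {c x} → Integral c → x ≈ 0ℚ → c * x ≈ 0ℚ
  *≈0 {c} C₀ e = ≈-trans (≈-*ˡ C₀ e) (≡⇒≈ (*-zeroʳ c))

  record Unit (x : ℚ) : Set where
    constructor unit
    field
      {inverse}        : ℚ
      inverse-integral : Integral inverse
      equation         : x * inverse ≡ 1ℚ

  Unit-1/suc : ∀ {k} → p ∤ suc k → Unit (ι (suc k))
  Unit-1/suc {k} p∤ = unit (Integral-1/suc p∤) (*-1/suc k)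

  Unit-* : ∀ {x y} → Unit x → Unit y → Unit (x * y)
  Unit-* {x} {y} (unit {u} U e) (unit {v} V e′) = unit (Integral-* U V) (linear₂ (y * v) 1ℚ e e′
    (solve 4 (λ x y u v → x :* y :* (u :* v) :- # 1 := y :* v :* (x :* u :- # 1) :+ # 1 :* (y :* v :- # 1)) refl x y
        u v))

  Unit-neg : ∀ {x} → Unit x → Unit (- x)
  Unit-neg {x} (unit {u} U e) = unit (Integral-neg U) (trans (solve 2 (λ x u → (:- x) :* (:- u) := x :* u) refl x u)
      e)

  Unit-factor : ∀ {c x} → Integral c → Unit (c * x) → Unit x
  Unit-factor {c} {x} C₀ (unit {u} U e) = unit (Integral-* C₀ U)
      (trans (solve 3 (λ c x u → x :* (c :* u) := c :* x :* u) refl c x u) e)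

  ≈-cancel : ∀ {c x y} → Unit c → c * x ≈ c * y → x ≈ y
  ≈-cancel {c} {x} {y} (unit {u} U e) h = subst₂ _≈_ (cancel x) (cancel y) (≈-*ˡ U h)
    where
    cancel : ∀ z → u * (c * z) ≡ z
    cancel z = linear₁ z e (solve 3 (λ u c z → u :* (c :* z) :- z := z :* (c :* u :- # 1)) refl u c z)

  -- Used to see that the leading coefficient of T is nonzero.
  1≉0 : ¬ (1ℚ ≈ 0ℚ)
  1≉0 (by {z} (integral {d} {a} {b} p∤d e) e′) = p∤d (∣m+n∣m⇒∣n {m = p ℕ.* b} (subst (p ∣_) (sym nat) (m∣m*n a))
      (m∣m*n b))
    where
    nat : p ℕ.* b ℕ.+ d ≡ p ℕ.* a
    nat = ι-injective (begin
      ι (p ℕ.* b ℕ.+ d)     ≡⟨ trans (ι-+ (p ℕ.* b) d) (cong (_+ ι d) (ι-* p b)) ⟩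
      ι p * ι b + ι d       ≡⟨ linear₂ (ι p) (ι d) e e′ (solve 5 (λ p z d a b → p :* b :+ d :- p :* a := p :*
          (d :* z :+ b :- a) :+ d :* (# 1 :- (# 0 :+ p :* z))) refl (ι p) z (ι d) (ι a) (ι b)) ⟩
      ι p * ι a             ≡⟨ ι-* p a ⟨
      ι (p ℕ.* a)           ∎)

-- Parity, row sums and ranges of summation.

sgn-even : ∀ r → sgn (dbl r) ≡ 1ℚ
sgn-even zero    = refl
sgn-even (suc r) = trans (solve 1 (λ s → (:- # 1) :* ((:- # 1) :* s) := s) refl (sgn (dbl r))) (sgn-even r)

m≤dbl : ∀ m → m ℕ.≤ dbl m
m≤dbl zero    = z≤n
m≤dbl (suc m) = s≤s (ℕₚ.m≤n⇒m≤1+n (m≤dbl m))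

dbl-mono : ∀ {j k} → j ℕ.≤ k → dbl j ℕ.≤ dbl k
dbl-mono z≤n     = z≤n
dbl-mono (s≤s e) = s≤s (s≤s (dbl-mono e))

sum-bin : ∀ m → sumℚ (suc m) (bin m) ≡ pow2 m
sum-bin zero    = refl
sum-bin (suc m) = begin
  sumℚ (suc (suc m)) (bin (suc m))
    ≡⟨ trans (sum-head (suc m) (bin (suc m))) (cong₂ _+_ (trans (bin-0 (suc m)) (sym (bin-0 m)))
        (trans (sum-ext (suc m) (bin-pascal m)) (sum-+ (suc m) (bin m) _))) ⟩
  bin m 0 + (sumℚ (suc m) (bin m) + sumℚ (suc m) (bin m ∘ suc))
    ≡⟨ linear₂ -1ℚ 1ℚ (sum-head (suc m) (bin m)) (bin-vanish {m} {suc m} ℕₚ.≤-refl)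
         (solve 4 (λ b s t v → b :+ (s :+ t) :- # 2 :* s := (:- # 1) :* ((s :+ v) :- (b :+ t)) :+ # 1 :* (v :- # 0))
           refl (bin m 0) (sumℚ (suc m) (bin m)) (sumℚ (suc m) (bin m ∘ suc)) (bin m (suc m))) ⟩
  2ℚ * sumℚ (suc m) (bin m)
    ≡⟨ cong (2ℚ *_) (sum-bin m) ⟩
  pow2 (suc m) ∎

altHarm : ∀ n → sumℚ (dbl n) (λ k → sgn k * 1/suc k) ≡ harm (dbl n) - harm n
altHarm zero    = refl
altHarm (suc n) = linear₃ 1ℚ 1ℚ (1/suc (dbl n) - 1/suc (suc (dbl n))) (altHarm n) (1/suc-dbl n) (sgn-even n)
  (solve 7 (λ a h h′ g i j k → (a :+ g :* i) :+ ((:- # 1) :* g) :* j :- (((h :+ i) :+ j) :- (h′ :+ k)) :=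
      # 1 :* (a :- (h :- h′)) :+ # 1 :* (k :- # 2 :* j) :+ (i :- j) :* (g :- # 1))
    refl (sumℚ (dbl n) (λ k → sgn k * 1/suc k)) (harm (dbl n)) (harm n) (sgn (dbl n)) (1/suc (dbl n))
        (1/suc (suc (dbl n))) (1/suc n))

dbl≡+ : ∀ m → dbl m ≡ m ℕ.+ m
dbl≡+ zero    = refl
dbl≡+ (suc m) = cong suc (trans (cong suc (dbl≡+ m)) (sym (ℕₚ.+-suc m m)))

sum-extend : ∀ d N {f : ℕ → ℚ} → (∀ j → f (j ℕ.+ N) ≡ 0ℚ) → sumℚ (d ℕ.+ N) f ≡ sumℚ N f
sum-extend zero    N h = refl
sum-extend (suc d) N h = trans (cong₂ _+_ (sum-extend d N h) (h d)) (+-identityʳ (sumℚ N _))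

-- Residues modulo p = 2n + 1 = 4r + 3, with n = 2r + 1.

module Residues (r : ℕ) (p-prime : Prime (suc (dbl (suc (dbl r))))) where

  n p : ℕ
  n = suc (dbl r)
  p = suc (dbl n)

  open Local p p-prime public

  ι-p : ι p ≡ odd n
  ι-p = trans (cong (1ℚ +_) (ι-dbl n)) (+-comm 1ℚ (2ℚ * ι n))

  n<p : n ℕ.< p
  n<p = s≤s (m≤dbl n)

  p∤small : ∀ {k} → suc k ℕ.< p → p ∤ suc k
  p∤small k<p = >⇒∤ k<p

  Unit-suc : ∀ {k} → suc k ℕ.< p → Unit (ι (suc k))
  Unit-suc k<p = Unit-1/suc (p∤small k<p)

  Unit-2 : Unit 2ℚ
  Unit-2 = Unit-suc {1} (s≤s (s≤s (s≤s z≤n)))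

  Integral-½ : Integral ½
  Integral-½ = Integral-1/suc {1} (p∤small (s≤s (s≤s (s≤s z≤n))))

  Integral-small : ∀ {k} → suc k ℕ.< p → Integral (1/suc k)
  Integral-small k<p = Integral-1/suc (p∤small k<p)

  Integral-odd : ∀ k → Integral (odd k)
  Integral-odd k = Integral-+ (Integral-* (Integral-ι 2) (Integral-ι k)) (Integral-ι 1)

  Integral-scale : ∀ {k} → suc k ℕ.< p → Integral ((½ * 1/suc k) * (½ * 1/suc k))
  Integral-scale k<p = Integral-* h h
    where
    h = Integral-* Integral-½ (Integral-small k<p)

  Integral-coef : ∀ k → k ℕ.< p → Integral (coef (odd n) k)
  Integral-coef zero    _   = Integral-ι 1
  Integral-coef (suc k) k<p = Integral-* (Integral-* (Integral-minus (Integral-* (Integral-odd k) (Integral-odd k))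
      (Integral-* (Integral-odd n) (Integral-odd n)))
    (Integral-coef k (ℕₚ.<-trans (ℕₚ.n<1+n k) k<p))) (Integral-scale k<p)

  Integral-deform : ∀ k → k ℕ.< p → Integral (deform (odd n) k)
  Integral-deform zero    _   = Integral-ι 0
  Integral-deform (suc k) k<p = Integral-* (Integral-+ (Integral-* (Integral-* (Integral-odd k) (Integral-odd k))
      (Integral-deform k k<p′)) (Integral-coef k k<p′)) (Integral-scale k<p)
    where
    k<p′ = ℕₚ.<-trans (ℕₚ.n<1+n k) k<p

  -- Since 2n + 1 ≡ 0, n + k + 1 ≡ -(n - k), hence (-1)ᵏ C(n+k,k) ≡ C(n,k).
  coef≈bin² : ∀ k → k ℕ.< p → coef (odd n) k ≈ bin n k * bin n k
  coef≈bin² zero    _   = ≡⇒≈ refl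
  coef≈bin² (suc k) k<p = ≈-cancel (Unit-* 2[1+k] 2[1+k])
    (≈-trans (≡⇒≈ (coef-recurrence (odd n) k))
      (≈-trans (≈-*ˡ (Integral-minus (Integral-* (Integral-odd k) (Integral-odd k)) (Integral-* (Integral-odd n)
          (Integral-odd n))) (coef≈bin² k (ℕₚ.<-trans (ℕₚ.n<1+n k) k<p)))
        (by (Integral-* (Integral-* (Integral-neg (Integral-ι 2)) (Integral-minus (Integral-odd n) (Integral-odd k)))
            (Integral-* (Integral-bin n k) (Integral-bin n k)))
          (linear₂ (- ι 4 * (ι (suc k) * bin n (suc k) + (ι n - ι k) * bin n k)) (2ℚ * (odd n - odd k) *
              (bin n k * bin n k)) (bin-ratio n k) ι-p
            (solve 5 (λ n k p b c → ((# 2 :* k :+ # 1) :* (# 2 :* k :+ # 1) :- (# 2 :* n :+ # 1) :*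
                (# 2 :* n :+ # 1)) :* (b :* b)
               :- ((# 2 :* (1+ k)) :* (# 2 :* (1+ k)) :* (c :* c) :+ p :*
                   ((:- # 2) :* ((# 2 :* n :+ # 1) :- (# 2 :* k :+ # 1)) :* (b :* b)))
               := (:- # 4) :* ((1+ k) :* c :+ (n :- k) :* b) :* ((1+ k) :* c :- (n :- k) :* b)
                  :+ # 2 :* ((# 2 :* n :+ # 1) :- (# 2 :* k :+ # 1)) :* (b :* b) :* (p :- (# 2 :* n :+ # 1)))
              refl (ι n) (ι k) (ι p) (bin n k) (bin n (suc k)))))))
    where
    2[1+k] = Unit-* Unit-2 (Unit-suc k<p)

  bsgn : ℕ → ℚ
  bsgn j = sgn j * bin n j

  S : ℚ → ℕ → ℚ
  S x m = pair (suc n) (binw x n) m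

  Integral-S : ∀ {x} m → Integral x → Integral (S x m)
  Integral-S m X = Integral-sum (suc n) (λ k _ → Integral-* (Integral-bin m k) (Integral-* (Integral-bin n k)
      (Integral-^ k X)))

  Integral-bsgn : ∀ j → Integral (bsgn j)
  Integral-bsgn j = Integral-* (Integral-sgn j) (Integral-bin n j)

  -- At x = 2 the middle coefficient is exactly 2n + 1, so modulo p even and odd rows decouple.
  S₂-recurrence : ∀ m → ι (suc (suc m)) * S 2ℚ (suc (suc m)) ≡ ι p * S 2ℚ (suc m) + ι (suc m) * S 2ℚ m
  S₂-recurrence m = trans (pair-recurrence 2ℚ n m) (linear₁ (- S 2ℚ (suc m)) ι-p
    (solve 5 (λ n p m a b → (n :* # 2 :+ # 1 :- (# 2 :- # 2) :* m) :* a :+ (# 2 :- # 1) :* m :* b :-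
        (p :* a :+ m :* b) := (:- a) :* (p :- (# 2 :* n :+ # 1)))
      refl (ι n) (ι p) (ι (suc m)) (S 2ℚ (suc m)) (S 2ℚ m)))

  S₂-odd : ∀ j → suc (dbl j) ℕ.< p → S 2ℚ (suc (dbl j)) ≈ 0ℚ
  S₂-odd zero    _   = by (Integral-ι 1) (trans (pair-1 2ℚ n) (linear₁ -1ℚ ι-p
    (solve 2 (λ n p → n :* # 2 :+ # 1 :- (# 0 :+ p :* # 1) := (:- # 1) :* (p :- (# 2 :* n :+ # 1))) refl (ι n)
        (ι p))))
  S₂-odd (suc j) j<p = ≈-cancel (Unit-suc j<p) (≈-trans (≡⇒≈ (S₂-recurrence (suc (dbl j))))
    (≈-trans (≈-+ (p*≈0 (Integral-S (suc (suc (dbl j))) (Integral-ι 2))) (*≈0 (Integral-ι (suc (suc (dbl j))))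
        (S₂-odd j (ℕₚ.<-trans (ℕₚ.m<n⇒m<1+n (ℕₚ.n<1+n _)) j<p))))
      (≡⇒≈ (sym (*-zeroʳ (ι (suc (suc (suc (dbl j)))))))) ))

  bsgn-suc : ∀ j → ι (suc j) * bsgn (suc j) ≡ - (ι n - ι j) * bsgn j
  bsgn-suc j = linear₁ (- sgn j) (bin-ratio n j)
    (solve 5 (λ n j g b c → (1+ j) :* ((:- # 1) :* g :* c) :- (:- (n :- j)) :* (g :* b) := (:- g) :*
        ((1+ j) :* c :- (n :- j) :* b))
      refl (ι n) (ι j) (sgn j) (bin n j) (bin n (suc j)))

  -- The surviving factor satisfies 2j + 1 ≡ -2(n - j), which reproduces the ratio of consecutive
  -- signed binomials.
  S₂-even : ∀ j → dbl j ℕ.< p → S 2ℚ (dbl j) ≈ bsgn j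
  S₂-even zero    _   = ≡⇒≈ (pair-0 n (binw 2ℚ n))
  S₂-even (suc j) j<p = ≈-cancel (Unit-suc j<p) (≈-trans (≡⇒≈ (S₂-recurrence (dbl j)))
    (≈-trans (≈-+ (p*≈0 (Integral-S (suc (dbl j)) (Integral-ι 2))) (≈-*ˡ (Integral-ι (suc (dbl j)))
        (S₂-even j (ℕₚ.<-trans (ℕₚ.m<n⇒m<1+n (ℕₚ.n<1+n _)) j<p))))
      (by (Integral-bsgn j) (linear₃ (- 2ℚ) (bsgn j - bsgn (suc j)) (- bsgn j) (bsgn-suc j) (ι-dbl j) ι-p
        (solve 6 (λ n j d p b b′ → # 0 :+ (1+ d) :* b :- ((1+ 1+ d) :* b′ :+ p :* b) :=
            (:- # 2) :* ((1+ j) :* b′ :- (:- (n :- j)) :* b) :+ (b :- b′) :* (d :- # 2 :* j) :+ (:- b) :*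
                (p :- (# 2 :* n :+ # 1)))
          refl (ι n) (ι j) (ι (dbl j)) (ι p) (bsgn j) (bsgn (suc j)))))))

  -- At x = 1 the recurrence has order one (Vandermonde gives C(n+m,m)), and n + m + 1 ≡ -(n - m).
  S₁≈bsgn : ∀ m → m ℕ.< p → S 1ℚ m ≈ bsgn m
  S₁≈bsgn zero    _   = ≡⇒≈ (pair-0 n (binw 1ℚ n))
  S₁≈bsgn (suc m) m<p = ≈-cancel (Unit-suc m<p) (≈-trans (≡⇒≈ (trans (pair-recurrence₀ 1ℚ n m)
      (solve 4 (λ n m s z → (n :* # 1 :+ # 1 :- (# 1 :- # 2) :* m) :* s :+ (# 1 :- # 1) :* z := (n :+ (1+ m)) :* s)
          refl (ι n) (ι m) (S 1ℚ m) (sumℚ (suc n) (λ k → (ι m - ι k) * bin m k * binw 1ℚ n k)))))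
    (≈-trans (≈-*ˡ (Integral-+ (Integral-ι n) (Integral-ι (suc m))) (S₁≈bsgn m (ℕₚ.<-trans (ℕₚ.n<1+n m) m<p)))
      (by (Integral-bsgn m) (linear₂ -1ℚ (- bsgn m) (bsgn-suc m) ι-p
        (solve 5 (λ n m p b b′ → (n :+ (1+ m)) :* b :- ((1+ m) :* b′ :+ p :* b) := (:- # 1) :*
            ((1+ m) :* b′ :- (:- (n :- m)) :* b) :+ (:- b) :* (p :- (# 2 :* n :+ # 1)))
          refl (ι n) (ι m) (ι p) (bsgn m) (bsgn (suc m)))))))

  bin≈sgn : ∀ k → k ℕ.< p → bin (dbl n) k ≈ sgn k
  bin≈sgn zero    _   = ≡⇒≈ (bin-0 (dbl n))
  bin≈sgn (suc k) k<p = ≈-cancel (Unit-suc k<p) (≈-trans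
    (by (Integral-bin (dbl n) k) (trans (bin-ratio (dbl n) k) (solve 3 (λ d k b → (d :- k) :* b := (:- (1+ k)) :* b
        :+ (1+ d) :* b) refl (ι (dbl n)) (ι k) (bin (dbl n) k))))
    (≈-trans (≈-*ˡ (Integral-neg (Integral-ι (suc k))) (bin≈sgn k (ℕₚ.<-trans (ℕₚ.n<1+n k) k<p)))
      (≡⇒≈ (solve 2 (λ s g → (:- s) :* g := s :* ((:- # 1) :* g)) refl (ι (suc k)) (sgn k)))))

  k<dbl⇒ : ∀ {k} → k ℕ.< dbl n → suc k ℕ.< p
  k<dbl⇒ = s≤s

  -- 1/(k+1) ≡ (-1)ᵏ C(p-1,k)/(k+1) = (-1)ᵏ C(p,k+1)/p, and summed over k this is an alternating row
  -- sum that vanishes exactly because p is odd.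
  harm≈0 : harm (dbl n) ≈ 0ℚ
  harm≈0 = ≈-trans (≈-sym (≈-sum (dbl n) (λ k k<d →
      ≈-trans (≈-*ˡ (Integral-sgn k) (≈-*ʳ (Integral-small (k<dbl⇒ k<d)) (bin≈sgn k (ℕₚ.m<n⇒m<1+n k<d))))
        (≡⇒≈ (linear₁ (1/suc k) (sgn-sq k) (solve 2 (λ g i → g :* (g :* i) :- i := i :* (g :* g :- # 1)) refl (sgn k)
            (1/suc k)))))))
    (≡⇒≈ (begin
      sumℚ (dbl n) (λ k → sgn k * (bin (dbl n) k * 1/suc k))
        ≡⟨ sum-ext (dbl n) (λ k → trans (cong (sgn k *_) (bin/suc (dbl n) k))
            (solve 3 (λ g i b → g :* (i :* b) := (:- i) :* (b :* ((:- # 1) :* g))) refl (sgn k) i (bin p (suc k)))) ⟩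
      sumℚ (dbl n) (λ k → - i * (bin p (suc k) * sgn (suc k)))
        ≡⟨ sum-* (- i) (dbl n) _ ⟩
      - i * s
        ≡⟨ linear₂ i (- i) (sum-head (dbl n) (λ k → bin p k * sgn k)) (trans (pair-sgn (dbl n) (dbl n))
            (cong (λ b → sgn (dbl n) * ι b) (nCn≡1 (dbl n))))
             (solve 4 (λ i s w g → (:- i) :* s :- (i :* (# 1 :- g)) := i :* (w :- (# 1 :* # 1 :+ s)) :+ (:- i) :*
                 (w :- g :* # 1)) refl i s (pair p sgn p) (sgn (dbl n))) ⟩
      i * (1ℚ - sgn (dbl n))
        ≡⟨ trans (cong (λ g → i * (1ℚ - g)) (sgn-even n)) (*-zeroʳ i) ⟩
      0ℚ ∎))
    where
    i s : ℚ
    i = 1/suc (dbl n)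
    s = sumℚ (dbl n) (λ k → bin p (suc k) * sgn (suc k))

  -- The Fermat quotient (2ᵖ - 2) / p.
  fermat : moment (dbl n) ≈ - harm n
  fermat = ≈-trans (≡⇒≈ (sym (begin
      sumℚ (dbl n) (λ k → bin (dbl n) k * 1/suc k)
        ≡⟨ trans (sum-ext (dbl n) (bin/suc (dbl n))) (sum-* i (dbl n) (bin p ∘ suc)) ⟩
      i * s
        ≡⟨ linear₃ (- i) i (- i) (cong (_+ bin p p) (sum-head (dbl n) (bin p))) (sum-bin p) (cong ι (nCn≡1 p))
             (solve 5 (λ i s w b x → i :* s :- (x :+ (:- # 1) :* # 1 :- # 1) :* i := (:- i) :*
                 ((w :+ b) :- ((# 1 :+ s) :+ b)) :+ i :* ((w :+ b) :- x) :+ (:- i) :* (b :- # 1)) refl i s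
                 (sumℚ p (bin p)) (bin p p) (pow2 p)) ⟩
      (pow2 p + -1ℚ * 1ℚ - 1ℚ) * i
        ≡⟨ cong (λ g → (pow2 p + -1ℚ * g - 1ℚ) * i) (sgn-even n) ⟨
      moment (dbl n) ∎)))
    -- C(p-1,k) ≡ (-1)ᵏ leaves the alternating harmonic sum, which is the harmonic number at p - 1,
    -- itself ≡ 0, minus the one at n.
    (≈-trans (≈-sum (dbl n) (λ k k<d → ≈-*ʳ (Integral-small (k<dbl⇒ k<d)) (bin≈sgn k (ℕₚ.m<n⇒m<1+n k<d))))
      (≈-trans (≡⇒≈ (altHarm n)) (≈-trans (≈-minus harm≈0 ≈-refl) (≡⇒≈ (+-identityˡ (- harm n))))))
    where
    i s : ℚ
    i = 1/suc (dbl n)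
    s = sumℚ (dbl n) (bin p ∘ suc)

  Integral-harm : Integral (harm n)
  Integral-harm = Integral-sum n (λ k k<n → Integral-small (ℕₚ.≤-<-trans k<n n<p))

  Integral-moment : Integral (moment (dbl n))
  Integral-moment = ≈-Integral (Integral-neg Integral-harm) fermat

  -- Fermat's little theorem for base 2, as the integrality of the quotient just computed.
  pow2-p : pow2 p ≈ 2ℚ
  pow2-p = by Integral-moment (linear₂ -1ℚ 1ℚ (suc*moment (dbl n)) (sgn-even n)
    (solve 4 (λ x g p m → x :- (# 2 :+ p :* m) := (:- # 1) :* (p :* m :- (x :+ (:- # 1) :* g :- # 1)) :+ # 1 :*
        (g :- # 1)) refl (pow2 p) (sgn (dbl n)) (ι p) (moment (dbl n))))

  p∤p+small : ∀ {k} → suc k ℕ.< p → p ∤ p ℕ.+ suc k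
  p∤p+small k<p p∣ = p∤small k<p (∣m+n∣m⇒∣n p∣ ∣-refl)

  1/[p+suc] : ∀ k → suc k ℕ.< p → 1/suc (dbl n ℕ.+ suc k) ≈ 1/suc k
  1/[p+suc] k k<p = by (Integral-neg (Integral-* (Integral-1/suc (p∤p+small k<p)) (Integral-small k<p)))
    (linear₂ (- j) i (*-1/suc k) (trans (cong (_* j) (sym (ι-+ p (suc k)))) (*-1/suc (dbl n ℕ.+ suc k)))
      (solve 4 (λ i j s p → j :- (i :+ p :* (:- (j :* i))) := (:- j) :* (s :* i :- # 1) :+ i :*
          ((p :+ s) :* j :- # 1)) refl i j (ι (suc k)) (ι p)))
    where
    i j : ℚ
    i = 1/suc k
    j = 1/suc (dbl n ℕ.+ suc k)

  -- Past the index p - 1, 2ᵖ ≡ 2, (-1)ᵖ = -1 and the denominator p + k + 1 reduces to k + 1.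
  moment-shift : ∀ k → suc k ℕ.< p → moment (dbl n ℕ.+ suc k) ≈ (2ℚ * pow2 (suc k) - sgn (suc k) - 1ℚ) * 1/suc k
  moment-shift k k<p = ≈-trans (≈-*ˡ (Integral-minus (Integral-+ (Integral-pow2 (p ℕ.+ suc k))
      (Integral-sgn (p ℕ.+ suc k))) (Integral-ι 1)) (1/[p+suc] k k<p))
    (≈-*ʳ (Integral-small k<p) (≈-minus {y = 1ℚ} {y′ = 1ℚ} (≈-+
      (≈-trans (≡⇒≈ (^-homo-* 2ℚ p (suc k))) (≈-*ʳ (Integral-pow2 (suc k)) pow2-p))
      (≡⇒≈ (trans (^-homo-* -1ℚ p (suc k)) (trans (cong (λ g → -1ℚ * g * sgn (suc k)) (sgn-even n))
          (solve 1 (λ g → (:- # 1) :* # 1 :* g := :- g) refl (sgn (suc k)))))))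
      ≈-refl))

  1^ : ∀ k → 1ℚ ^^ k ≡ 1ℚ
  1^ zero    = refl
  1^ (suc k) = trans (*-identityˡ (1ℚ ^^ k)) (1^ k)

  H Y : ℚ
  H = harm n
  Y = pairHarm r sgn n

  -- Position j stands for row j + 1, so the vanishing positions 2j are the odd rows; the unpaired
  -- last position 2r is one of them.
  pairs : (f g : ℕ → ℚ) → (∀ j → suc (dbl j) ℕ.≤ n → f (dbl j) ≈ 0ℚ) → (∀ j → j ℕ.< r → f (suc (dbl j)) ≈ g j) → sumℚ
      n f ≈ sumℚ r g
  pairs f g h h′ = ≈-trans (≈-+ (go r ℕₚ.≤-refl) (h r ℕₚ.≤-refl)) (≡⇒≈ (+-identityʳ (sumℚ r g)))
    where
    go : ∀ m → m ℕ.≤ r → sumℚ (dbl m) f ≈ sumℚ m g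
    go zero    _   = ≈-refl
    go (suc m) m<r = ≈-trans (≈-+ (≈-+ (go m (ℕₚ.<⇒≤ m<r)) (h m (s≤s (dbl-mono (ℕₚ.<⇒≤ m<r))))) (h′ m m<r))
      (≡⇒≈ (cong (_+ g m) (+-identityʳ (sumℚ m g))))

  -- Only even rows 2j ≤ n survive, whence the cut-off r in `Y`; the factor 2 turns 1/(2j) into 1/j.
  pairHarm₂ : 2ℚ * pairHarm n (binw 2ℚ n) n ≈ Y - 2ℚ * H
  pairHarm₂ = ≈-trans (≡⇒≈ (trans (cong (2ℚ *_) (pairHarm-sum n (binw 2ℚ n) n refl))
      (trans (solve 2 (λ a h → # 2 :* (a :- h) := # 2 :* a :- # 2 :* h) refl (sumℚ n f) H)
          (cong (_- 2ℚ * H) (sym (sum-* 2ℚ n f))))))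
    (≈-minus (pairs (λ j → 2ℚ * f j) (λ j → bin n (suc j) * sgn (suc j) * 1/suc j)
       (λ j j<n → *≈0 (Integral-ι 2) (≈-trans (≈-*ʳ (Integral-small (ℕₚ.≤-<-trans j<n n<p))
           (S₂-odd j (ℕₚ.≤-<-trans j<n n<p))) (≡⇒≈ (*-zeroˡ (1/suc (dbl j))))))
       even) ≈-refl)
    where
    f : ℕ → ℚ
    f j = S 2ℚ (suc j) * 1/suc j
    dbl-< : ∀ {j k} → j ℕ.< k → suc (dbl j) ℕ.< dbl k
    dbl-< {zero}  (s≤s z≤n) = s≤s (s≤s z≤n)
    dbl-< {suc j} (s≤s e)   = s≤s (s≤s (dbl-< e))
    even : ∀ j → j ℕ.< r → 2ℚ * f (suc (dbl j)) ≈ bin n (suc j) * sgn (suc j) * 1/suc j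
    even j j<r = ≈-trans (≈-*ˡ (Integral-ι 2) (≈-*ʳ (Integral-small 2j+2<p) (S₂-even (suc j) 2j+2<p)))
      (≡⇒≈ (linear₁ (- (bin n (suc j) * sgn (suc j))) (1/suc-dbl j)
        (solve 4 (λ b g i k → # 2 :* (g :* b :* k) :- b :* g :* i := (:- (b :* g)) :* (i :- # 2 :* k)) refl
            (bin n (suc j)) (sgn (suc j)) (1/suc j) (1/suc (suc (dbl j))))))
      where
      2j+2<p : suc (suc (dbl j)) ℕ.< p
      2j+2<p = ℕₚ.<-trans (s≤s (dbl-< j<r)) n<p

  pairHarm₁ : pairHarm n (binw 1ℚ n) n ≈ - 2ℚ * H
  pairHarm₁ = ≈-trans (≡⇒≈ (pairHarm-sum n (binw 1ℚ n) n refl))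
    (≈-trans (≈-minus (≈-sum n (λ j j<n → ≈-*ʳ (Integral-small (ℕₚ.≤-<-trans j<n n<p))
        (S₁≈bsgn (suc j) (ℕₚ.≤-<-trans j<n n<p)))) ≈-refl)
      (≡⇒≈ (trans (cong (_- H) (trans (sum-ext n (λ j → cong (_* 1/suc j) (*-comm (sgn (suc j)) (bin n (suc j)))))
          (pairHarm-sgn n)))
        (solve 1 (λ h → (:- h) :- h := (:- # 2) :* h) refl H))))

  -- This is ∫ x^(p-1) T. The term k = 0 gives -H, and the weights 2·2ᵏ, -(-1)ᵏ and -1 give Y - 2H,
  -- -(Y - H) and 2H.
  weighted-moments : sumℚ (suc n) (λ k → coef (odd n) k * moment (dbl n ℕ.+ k)) ≈ 0ℚ
  weighted-moments = ≈-trans (≡⇒≈ (trans (sum-head n _)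
      (cong (_+ sumℚ n (λ k → coef (odd n) (suc k) * moment (dbl n ℕ.+ suc k)))
      (trans (*-identityˡ (moment (dbl n ℕ.+ 0))) (cong moment (ℕₚ.+-identityʳ (dbl n)))))))
    (≈-trans (≈-+ fermat (≈-sum n term))
      (≈-trans (≡⇒≈ (cong (- H +_) (trans (sum-+ n _ _) (cong₂ _+_ (sum-* 2ℚ n _) (sum-linear -1ℚ -1ℚ n _ _)))))
        (≈-trans (≈-+ (≈-refl {x = - H}) (≈-+ pairHarm₂ (≈-+ (≡⇒≈ (cong (-1ℚ *_) (sqHarm-odd r)))
            (≈-*ˡ (Integral-neg (Integral-ι 1)) pairHarm₁))))
          (≡⇒≈ (solve 2 (λ h y → (:- h) :+ ((y :- # 2 :* h) :+ ((:- # 1) :* (y :- h) :+ (:- # 1) :* ((:- # 2) :* h)))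
              := # 0) refl H Y)))))
    where
    term : ∀ k → k ℕ.< n → coef (odd n) (suc k) * moment (dbl n ℕ.+ suc k) ≈
      2ℚ * (bin n (suc k) * binw 2ℚ n (suc k) * 1/suc k) + (-1ℚ * (bin n (suc k) * binw -1ℚ n (suc k) * 1/suc k) +
          -1ℚ * (bin n (suc k) * binw 1ℚ n (suc k) * 1/suc k))
    term k k<n = ≈-trans (≈-*ˡ (Integral-coef (suc k) k<p) (moment-shift k k<p))
      (≈-trans (≈-*ʳ (Integral-* (Integral-minus (Integral-minus (Integral-* (Integral-ι 2) (Integral-pow2 (suc k)))
          (Integral-sgn (suc k))) (Integral-ι 1)) (Integral-small k<p)) (coef≈bin² (suc k) k<p))
        (≡⇒≈ (linear₁ (b * b * 1/suc k) (1^ (suc k))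
          (solve 5 (λ b x g i o → b :* b :* ((# 2 :* x :- g :- # 1) :* i) :- (# 2 :* (b :* (b :* x) :* i) :+
              ((:- # 1) :* (b :* (b :* g) :* i) :+ (:- # 1) :* (b :* (b :* o) :* i)))
             := b :* b :* i :* (o :- # 1)) refl b (pow2 (suc k)) (sgn (suc k)) (1/suc k) (1ℚ ^^ suc k)))))
      where
      k<p : suc k ℕ.< p
      k<p = ℕₚ.≤-<-trans k<n n<p
      b : ℚ
      b = bin n (suc k)

  -- The congruence for G(2) + G(-1).

  -- Compare leading coefficients of T(1 - X) and T(X) in odd degree n. The leading coefficient can
  -- be cancelled since it is ≡ C(n,n)² = 1 modulo p.
  reflected-0 : reflected n 0 ≡ -1ℚ
  reflected-0 = linear₂ (- (1ℚ + u)) t⁻¹ (*-inverseʳ t) top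
    (solve 3 (λ u t i → u :- (:- # 1) := (:- (# 1 :+ u)) :* (t :* i :- # 1) :+ i :* (t :- u :* ((:- # 1) :* t))) refl
        u t t⁻¹)
    where
    t u t⁻¹ : ℚ
    t = coef (odd n) n
    u = reflected n 0
    t≢0 : t ≢ 0ℚ
    t≢0 e = 1≉0 (≈-trans (≡⇒≈ (cong (λ b → ι b * ι b) (sym (nCn≡1 n)))) (≈-trans (≈-sym (coef≈bin² n n<p)) (≡⇒≈ e)))
    instance _ = ≢-nonZero t≢0
    t⁻¹ = 1/ t
    top : t ≡ u * (-1ℚ * t)
    top = trans (sym (reflected-top n)) (trans (reflected-coef n n) (cong (λ g → u * (g * t)) (sgn-odd r)))

  open Legendre n reflected-0 public

  k<N⇒ : ∀ {k} → k ℕ.< N → k ℕ.< p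
  k<N⇒ k<N = ℕₚ.≤-trans k<N n<p

  τ≈0 : τ ≈ 0ℚ
  τ≈0 = ≈-trans (≈-sum N (λ k k<N → ≈-*ʳ (Integral-sgn k) (coef≈bin² k (k<N⇒ k<N))))
    (≡⇒≈ (trans (sum-ext N (λ k → *-assoc (bin n k) (bin n k) (sgn k))) (altSq-odd r)))

  -- k C(n,k) = n (C(n,k) - C(n-1,k)) reduces the sum to `altSq n`, which vanishes, and
  -- `altMix (dbl r)`.
  θ≈ : θ ≈ - ι n * central r
  θ≈ = ≈-trans (≈-sum N (λ k k<N → ≈-*ʳ (Integral-* (Integral-ι k) (Integral-sgn k)) (coef≈bin² k (k<N⇒ k<N))))
    (≡⇒≈ (begin
      sumℚ N (λ k → bin n k * bin n k * (ι k * sgn k))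
        ≡⟨ sum-ext N (λ k → linear₁ (- (bin n k * sgn k)) (bin-lower (dbl r) k)
             (solve 5 (λ n k b c g → b :* b :* (k :* g) :- (n :* (b :* (b :* g)) :+ (:- n) :* (c :* (b :* g))) :=
                 (:- (b :* g)) :* ((n :- k) :* b :- n :* c))
               refl (ι n) (ι k) (bin n k) (bin (dbl r) k) (sgn k))) ⟩
      sumℚ N (λ k → ι n * (bin n k * binw -1ℚ n k) + - ι n * (bin (dbl r) k * binw -1ℚ n k))
        ≡⟨ sum-linear (ι n) (- ι n) N _ _ ⟩
      ι n * altSq n + - ι n * pair N (binw -1ℚ n) (dbl r)
        ≡⟨ cong₂ (λ a b → ι n * a + - ι n * b) (altSq-odd r) (trans (altMix-symmetric (dbl r))
            (trans (altMix-even r) (altSq-even r))) ⟩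
      ι n * 0ℚ + - ι n * central r
        ≡⟨ solve 2 (λ n c → n :* # 0 :+ (:- n) :* c := (:- n) :* c) refl (ι n) (central r) ⟩
      - ι n * central r ∎))

  Unit-central : ∀ j → j ℕ.≤ r → Unit (central j)
  Unit-central zero    _   = unit (Integral-ι 1) refl
  Unit-central (suc j) j<r = Unit-factor (Integral-ι (suc j)) (subst Unit (sym (central-suc j))
    (Unit-* (Unit-* (Unit-neg Unit-2) (subst Unit (cong (1ℚ +_) (ι-dbl j))
        (Unit-suc (ℕₚ.≤-<-trans (s≤s (dbl-mono (ℕₚ.<⇒≤ j<r))) n<p))))
      (Unit-central j (ℕₚ.<⇒≤ j<r))))

  -- For 0 < m < 2p the only multiple of p is m = p itself, so p / m is always p-integral.
  Integral-p/ : ∀ m → suc m ℕ.< p ℕ.+ p → Integral (ι p * 1/suc m)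
  Integral-p/ m m<2p with ℕₚ.<-cmp (suc m) p
  ... | tri< m<p _ _  = Integral-* (Integral-ι p) (Integral-small m<p)
  ... | tri≈ _ refl _ = subst Integral (sym (*-1/suc m)) (Integral-ι 1)
  ... | tri> _ _ p<m  with ℕₚ.m≤n⇒∃[o]m+o≡n p<m
  ...   | o , refl    = Integral-* (Integral-ι p)
      (Integral-1/suc (λ p∣ → p∤p+small {o} o<p (subst (p ∣_) (sym (ℕₚ.+-suc p o)) p∣)))
    where
    o<p : suc o ℕ.< p
    o<p = ℕₚ.+-cancelˡ-< p (suc o) p (subst (ℕ._< p ℕ.+ p) (sym (ℕₚ.+-suc p o)) m<2p)

  -- One of the moments may be written with denominator p. Multiplying by p is affordable because
  -- `boundary` contains p² `Λ m`.
  Integral-pΛ : ∀ m → m ℕ.< p → Integral (ι p * Λ m)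
  Integral-pΛ m m<p = subst Integral (sum-* (ι p) N _) (Integral-sum N (λ k k<N →
    subst Integral (solve 4 (λ p t e i → t :* e :* (p :* i) := p :* (t :* (e :* i))) refl (ι p) (t k)
        (endpoints (suc (m ℕ.+ k))) (1/suc (m ℕ.+ k)))
      (Integral-* (Integral-* (Integral-coef k (k<N⇒ k<N))
          (Integral-minus (Integral-+ (Integral-pow2 (suc (m ℕ.+ k))) (Integral-sgn (suc (m ℕ.+ k)))) (Integral-ι 1)))
        (Integral-p/ (m ℕ.+ k) (ℕₚ.+-mono-≤-< m<p (k<N⇒ k<N))))))

  κ : ℕ → ℚ
  κ k = pow2 k + sgn k

  Integral-κ : ∀ k → Integral (κ k)
  Integral-κ k = Integral-+ (Integral-pow2 k) (Integral-sgn k)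

  boundary≈ : ∀ m → m ℕ.< p → boundary m ≈ - ι 8 * θ * κ m
  boundary≈ m m<p = ≈-trans (≈-minus (≈-+ (≈-refl {x = - ι 8 * θ * κ m})
        (≈-trans (≡⇒≈ (solve 4 (λ f m t x → f :* m :* t :* x := f :* m :* x :* t) refl (ι 4) (ι m) τ
            (pow2 m + 2ℚ * sgn m)))
          (*≈0 (Integral-* (Integral-* (Integral-ι 4) (Integral-ι m)) (Integral-+ (Integral-pow2 m)
              (Integral-* (Integral-ι 2) (Integral-sgn m)))) τ≈0)))
      (≈-trans (≡⇒≈ (trans (cong (λ o → o * o * Λ m) (sym ι-p)) (*-assoc (ι p) (ι p) (Λ m))))
          (p*≈0 (Integral-pΛ m m<p))))
    (≡⇒≈ (solve 1 (λ a → (a :+ # 0) :- # 0 := a) refl (- ι 8 * θ * κ m)))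

  W : ℚ
  W = sumℚ (dbl n) (λ k → deform (odd n) (suc k) * κ (suc k))

  Integral-W : Integral W
  Integral-W = Integral-sum (dbl n) (λ k k<d → Integral-* (Integral-deform (suc k) (k<dbl⇒ k<d)) (Integral-κ (suc k)))

  coef-extend : ∀ (f : ℕ → ℚ) d → sumℚ (d ℕ.+ N) (λ k → t k * f k) ≡ sumℚ N (λ k → t k * f k)
  coef-extend f d = sum-extend d N (λ j → trans (cong (_* f (j ℕ.+ N)) (trans (cong t (ℕₚ.+-suc j n))
      (coef-vanish n j))) (*-zeroˡ (f (j ℕ.+ N))))

  dbl-r+N : dbl r ℕ.+ N ≡ dbl n
  dbl-r+N = trans (ℕₚ.+-suc (dbl r) n) (sym (dbl≡+ n))

  -- `deform-pairing` up to p - 1 with L = `Λ`: the left side is ∫ T² = 0, the end term carries `Λ`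
  -- at p - 1, and the remaining sum is that of `deform` against `boundary`.
  8θW≈0 : - ι 8 * θ * W ≈ 0ℚ
  8θW≈0 = ≈-trans (≈-sym (≈-trans (≈-sum (dbl n) (λ k k<d → ≈-trans (≈-*ˡ (Integral-deform (suc k) (k<dbl⇒ k<d))
      (≈-trans (≡⇒≈ (Λ-recurrence k)) (boundary≈ (suc k) (k<dbl⇒ k<d))))
        (≡⇒≈ (solve 3 (λ g c x → g :* (c :* x) := c :* (g :* x)) refl (deform (odd n) (suc k)) (- ι 8 * θ)
            (κ (suc k))))))
      (≡⇒≈ (sum-* (- ι 8 * θ) (dbl n) _))))
    (≈-trans (≡⇒≈ (linear₂ -1ℚ 1ℚ (deform-pairing (odd n) Λ (dbl n)) total
        (solve 3 (λ s a b → s :- (:- a) := (:- # 1) :* (b :- (a :+ s)) :+ # 1 :* (b :- # 0))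
        refl (sumℚ (dbl n) (λ k → deform (odd n) (suc k) * ((2ℚ * ι (suc k)) * (2ℚ * ι (suc k)) * Λ k - odd (suc k) *
            odd (suc k) * Λ (suc k)))) top (sumℚ (dbl n) (λ k → t k * Λ k)))))
      (≈-neg {y = 0ℚ} (*≈0 (Integral-* (Integral-* (Integral-odd (dbl n)) (Integral-odd (dbl n)))
          (Integral-deform (dbl n) ℕₚ.≤-refl)) weighted-moments)))
    where
    top : ℚ
    top = odd (dbl n) * odd (dbl n) * deform (odd n) (dbl n) * Λ (dbl n)
    total : sumℚ (dbl n) (λ k → t k * Λ k) ≡ 0ℚ
    total = trans (cong (λ M → sumℚ M (λ k → t k * Λ k)) (sym dbl-r+N)) (trans (coef-extend Λ (dbl r)) Λ-self)

  W≈0 : W ≈ 0ℚ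
  W≈0 = ≈-cancel (Unit-* (Unit-neg (Unit-* Unit-2 (Unit-* Unit-2 Unit-2))) (Unit-* (Unit-neg (Unit-suc n<p))
      (Unit-central r ℕₚ.≤-refl)))
    (≈-trans (≈-*ʳ Integral-W (≈-*ˡ (Integral-neg (Integral-ι 8)) (≈-sym θ≈)))
        (≈-trans 8θW≈0 (≡⇒≈ (sym (*-zeroʳ (- ι 8 * (- ι n * central r)))))))

  -- An exact equality, because T(2) + T(-1) = 0 holds exactly; hence a congruence for `W` modulo p
  -- is enough for p³.
  sum-κ : sumℚ p (λ k → coef 0ℚ k * κ k) ≡ ι p * ι p * W
  sum-κ = begin
    sumℚ p (λ k → coef 0ℚ k * κ k)
      ≡⟨ sum-ext p (λ k → trans (cong (_* κ k) (coef-deform (odd n) k))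
           (solve 5 (λ c o g x y → (c :+ o :* o :* g) :* (x :+ y) := c :* x :+ c :* y :+ o :* o :* (g :* (x :+ y)))
               refl (t k) (odd n) (deform (odd n) k) (pow2 k) (sgn k))) ⟩
    sumℚ p (λ k → t k * pow2 k + t k * sgn k + odd n * odd n * (deform (odd n) k * κ k))
      ≡⟨ trans (sum-+ p _ _) (cong₂ _+_ (sum-+ p _ _) (sum-* (odd n * odd n) p _)) ⟩
    sumℚ p (λ k → t k * pow2 k) + sumℚ p (λ k → t k * sgn k) + odd n * odd n * sumℚ p (λ k → deform (odd n) k * κ k)
      ≡⟨ cong₂ (λ a b → a + b + odd n * odd n * sumℚ p (λ k → deform (odd n) k * κ k)) (trans (extended pow2) τ₂≡-τ)
          (extended sgn) ⟩
    - τ + τ + odd n * odd n * sumℚ p (λ k → deform (odd n) k * κ k)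
      ≡⟨ cong (λ s → - τ + τ + odd n * odd n * s) (sum-head (dbl n) (λ k → deform (odd n) k * κ k)) ⟩
    - τ + τ + odd n * odd n * (0ℚ * κ 0 + W)
      ≡⟨ solve 4 (λ a o c w → :- a :+ a :+ o :* o :* (# 0 :* c :+ w) := o :* o :* w) refl τ (odd n) (κ 0) W ⟩
    odd n * odd n * W
      ≡⟨ cong (λ o → o * o * W) ι-p ⟨
    ι p * ι p * W ∎
    where
    extended : ∀ (f : ℕ → ℚ) → sumℚ p (λ k → t k * f k) ≡ sumℚ N (λ k → t k * f k)
    extended f = trans (cong (λ M → sumℚ (suc M) (λ k → t k * f k)) (sym dbl-r+N)) (coef-extend f (suc (dbl r)))

-- The summands of the theorem as values of `coef` at P = 0.

/1≡ι : ∀ m → ℤ.+ m / 1 ≡ ι m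
/1≡ι zero    = refl
/1≡ι (suc m) = trans (toℚᵘ-injective (begin-equality
    toℚᵘ (ℤ.+ suc m / 1)              ≃⟨ toℚᵘ-fromℚᵘ (mkℚᵘ (ℤ.+ suc m) 0) ⟩
    mkℚᵘ (ℤ.+ suc m) 0                ≃⟨ *≡* (cong (ℤ._* ℤ.+ 1) (cong₂ ℤ._+_ (refl {x = ℤ.+ 1})
        (sym (ℤₚ.*-identityʳ (ℤ.+ m))))) ⟩
    toℚᵘ 1ℚ ℚᵘ.+ mkℚᵘ (ℤ.+ m) 0       ≃⟨ ℚᵘₚ.+-congʳ (toℚᵘ 1ℚ) (ℚᵘₚ.≃-sym (toℚᵘ-fromℚᵘ (mkℚᵘ (ℤ.+ m) 0))) ⟩
    toℚᵘ 1ℚ ℚᵘ.+ toℚᵘ (ℤ.+ m / 1)     ≃⟨ ℚᵘₚ.≃-sym (toℚᵘ-homo-+ 1ℚ (ℤ.+ m / 1)) ⟩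
    toℚᵘ (1ℚ + (ℤ.+ m / 1))           ∎′)) (cong (_+_ 1ℚ) (/1≡ι m))
  where open ℚᵘₚ.≤-Reasoning renaming (_∎ to _∎′)

ι*/ : ∀ m d .{{_ : ℕ.NonZero d}} → ι d * (ℤ.+ m / d) ≡ ι m
ι*/ m d@(suc d-1) = trans (cong (_* (ℤ.+ m / d)) (sym (/1≡ι d))) (trans (toℚᵘ-injective (begin-equality
    toℚᵘ ((ℤ.+ d / 1) * (ℤ.+ m / d))              ≃⟨ toℚᵘ-homo-* (ℤ.+ d / 1) (ℤ.+ m / d) ⟩
    toℚᵘ (ℤ.+ d / 1) ℚᵘ.* toℚᵘ (ℤ.+ m / d)        ≃⟨ ℚᵘₚ.*-cong (toℚᵘ-fromℚᵘ (mkℚᵘ (ℤ.+ d) 0))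
        (toℚᵘ-fromℚᵘ (mkℚᵘ (ℤ.+ m) d-1)) ⟩
    mkℚᵘ (ℤ.+ d) 0 ℚᵘ.* mkℚᵘ (ℤ.+ m) d-1          ≃⟨ *≡* (trans (ℤₚ.*-identityʳ (ℤ.+ d ℤ.* ℤ.+ m))
        (trans (ℤₚ.*-comm (ℤ.+ d) (ℤ.+ m)) (cong (λ e → ℤ.+ m ℤ.* ℤ.+ e) (sym (ℕₚ.*-identityˡ d))))) ⟩
    mkℚᵘ (ℤ.+ m) 0                              ≃⟨ ℚᵘₚ.≃-sym (toℚᵘ-fromℚᵘ (mkℚᵘ (ℤ.+ m) 0)) ⟩
    toℚᵘ (ℤ.+ m / 1)                            ∎′)) (/1≡ι m))
  where open ℚᵘₚ.≤-Reasoning renaming (_∎ to _∎′)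

*-cancel-ι : ∀ m .{{_ : ℕ.NonZero m}} {x y} → ι m * x ≡ ι m * y → x ≡ y
*-cancel-ι (suc m) = *-cancel-suc m

neg-/ : ∀ i d .{{_ : ℕ.NonZero d}} → (ℤ.- i) / d ≡ - (i / d)
neg-/ (ℤ.+ zero)  d = *-cancel-ι d (trans (ι*/ 0 d) (trans (solve 0 (# 0 := :- # 0) refl)
    (trans (cong -_ (sym (ι*/ 0 d))) (neg-distribʳ-* (ι d) (ℤ.+ 0 / d)))))
neg-/ (ℤ.+ suc m) d = refl
neg-/ -[1+ m ]  d = solve 1 (λ x → x := :- (:- x)) refl (ℤ.+ suc m / d)

sgn-/ : ∀ k i d .{{_ : ℕ.NonZero d}} → ((ℤ.- ℤ.1ℤ) ℤ.^ k ℤ.* i) / d ≡ sgn k * (i / d)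
sgn-/ zero    i d = trans (cong (_/ d) (ℤₚ.*-identityˡ i)) (sym (*-identityˡ (i / d)))
sgn-/ (suc k) i d = trans (cong (_/ d) (trans (ℤₚ.*-assoc (ℤ.- ℤ.1ℤ) ((ℤ.- ℤ.1ℤ) ℤ.^ k) i)
    (ℤₚ.-1*i≡-i ((ℤ.- ℤ.1ℤ) ℤ.^ k ℤ.* i))))
  (trans (neg-/ ((ℤ.- ℤ.1ℤ) ℤ.^ k ℤ.* i) d) (trans (cong -_ (sgn-/ k i d))
      (solve 2 (λ g x → :- (g :* x) := (:- # 1) :* g :* x) refl (sgn k) (i / d))))

8^2^≡16^ : ∀ k → ι (8 ℕ.^ k) * pow2 k ≡ ι (16 ℕ.^ k)
8^2^≡16^ zero    = refl
8^2^≡16^ (suc k) = trans (cong (_* pow2 (suc k)) (ι-* 8 (8 ℕ.^ k))) (trans (linear₁ (ι 16) (8^2^≡16^ k)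
  (solve 3 (λ a b c → # 8 :* a :* (# 2 :* b) :- # 16 :* c := # 16 :* (a :* b :- c)) refl (ι (8 ℕ.^ k)) (pow2 k)
      (ι (16 ℕ.^ k)))) (sym (ι-* 16 (16 ℕ.^ k))))

16^*coef : ∀ k → ι (16 ℕ.^ k) * coef 0ℚ k ≡ bin (dbl k) k * bin (dbl k) k
16^*coef zero    = refl
16^*coef (suc k) = *-cancel-4suc² k (begin
  q * (ι (16 ℕ.^ suc k) * c′)
    ≡⟨ cong (λ a → q * (a * c′)) (ι-* 16 (16 ℕ.^ k)) ⟩
  q * (ι 16 * ι (16 ℕ.^ k) * c′)
    ≡⟨ linear₃ (ι 16 * ι (16 ℕ.^ k)) (ι 16 * odd k * odd k) (- ι 4 * (ι (suc k) * b′ + 2ℚ * (1ℚ + 2ℚ * ι k) * b))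
        (coef-recurrence 0ℚ k) (16^*coef k) (central-recurrence k)
         (solve 6 (λ k s c c′ b b′ → (# 2 :* (1+ k)) :* (# 2 :* (1+ k)) :* (# 16 :* s :* c′) :- (# 2 :* (1+ k)) :*
             (# 2 :* (1+ k)) :* (b′ :* b′) :=
             # 16 :* s :* ((# 2 :* (1+ k)) :* (# 2 :* (1+ k)) :* c′ :- ((# 2 :* k :+ # 1) :* (# 2 :* k :+ # 1) :- # 0
                 :* # 0) :* c)
             :+ # 16 :* (# 2 :* k :+ # 1) :* (# 2 :* k :+ # 1) :* (s :* c :- b :* b)
             :+ (:- # 4) :* ((1+ k) :* b′ :+ # 2 :* (# 1 :+ # 2 :* k) :* b) :* ((1+ k) :* b′ :- # 2 :*
                 (# 1 :+ # 2 :* k) :* b))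
           refl (ι k) (ι (16 ℕ.^ k)) (coef 0ℚ k) c′ b b′) ⟩
  q * (b′ * b′) ∎)
  where
  q b b′ c′ : ℚ
  q  = (2ℚ * ι (suc k)) * (2ℚ * ι (suc k))
  b  = bin (dbl k) k
  b′ = bin (dbl (suc k)) (suc k)
  c′ = coef 0ℚ (suc k)

ι-central² : ∀ k → ι (((2 ℕ.* k) C k) ℕ.^ 2) ≡ bin (dbl k) k * bin (dbl k) k
ι-central² k = trans (cong (λ m → ι ((m C k) ℕ.^ 2)) (trans (cong (k ℕ.+_) (ℕₚ.+-identityʳ k)) (sym (dbl≡+ k))))
  (trans (ι-* (dbl k C k) _) (cong (bin (dbl k) k *_) (cong ι (ℕₚ.*-identityʳ (dbl k C k)))))

term8≡ : ∀ k → term8 k ≡ coef 0ℚ k * pow2 k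
term8≡ k = *-cancel-ι (8 ℕ.^ k) (begin
  ι (8 ℕ.^ k) * term8 k                       ≡⟨ ι*/ (((2 ℕ.* k) C k) ℕ.^ 2) (8 ℕ.^ k) ⟩
  ι (((2 ℕ.* k) C k) ℕ.^ 2)                   ≡⟨ trans (ι-central² k) (sym (16^*coef k)) ⟩
  ι (16 ℕ.^ k) * coef 0ℚ k                    ≡⟨ cong (_* coef 0ℚ k) (8^2^≡16^ k) ⟨
  ι (8 ℕ.^ k) * pow2 k * coef 0ℚ k            ≡⟨ solve 3 (λ a b c → a :* b :* c := a :* (c :* b)) refl (ι (8 ℕ.^ k))
      (pow2 k) (coef 0ℚ k) ⟩
  ι (8 ℕ.^ k) * (coef 0ℚ k * pow2 k)          ∎)
  where instance _ = ℕₚ.m^n≢0 8 k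

term-16≡ : ∀ k → term-16 k ≡ coef 0ℚ k * sgn k
term-16≡ k = trans (sgn-/ k (ℤ.+ m) (16 ℕ.^ k)) (trans (*-comm (sgn k) (ℤ.+ m / 16 ℕ.^ k)) (cong (_* sgn k)
  (*-cancel-ι (16 ℕ.^ k) (trans (ι*/ m (16 ℕ.^ k)) (trans (ι-central² k) (sym (16^*coef k)))))))
  where
  m : ℕ
  m = ((2 ℕ.* k) C k) ℕ.^ 2
  instance _ = ℕₚ.m^n≢0 16 k

-- From p-integrality to reduced numerators and denominators.

ι-denominator : ∀ x → ι (↧ₙ x) * x ≡ ι ℤ.∣ ↥ x ∣ ⊎ ι (↧ₙ x) * x ≡ - ι ℤ.∣ ↥ x ∣
ι-denominator x@(mkℚ (ℤ.+ m)    d-1 c) = inj₁ (trans (cong (ι (suc d-1) *_) (sym (normalize-coprime c)))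
    (ι*/ m (suc d-1)))
ι-denominator x@(mkℚ -[1+ m ] d-1 c) = inj₂ (trans (cong (λ y → ι (suc d-1) * - y) (sym (normalize-coprime c)))
  (trans (sym (neg-distribʳ-* (ι (suc d-1)) (ℤ.+ suc m / suc d-1))) (cong -_ (ι*/ (suc m) (suc d-1)))))

module _ (p : ℕ) (p-prime : Prime p) where

  open Local p p-prime

  p^∣-cancel : ∀ j {d m} → p ∤ d → p ℕ.^ j ∣ d ℕ.* m → p ℕ.^ j ∣ m
  p^∣-cancel zero    {d} {m} p∤d h = divides m (sym (ℕₚ.*-identityʳ m))
  p^∣-cancel (suc j) {d} {m} p∤d h with euclidsLemma d m p-prime (∣-trans (m∣m*n (p ℕ.^ j)) h)
  ... | inj₁ p∣d              = contradiction p∣d p∤d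
  ... | inj₂ (divides q refl) = subst (p ℕ.* p ℕ.^ j ∣_) (ℕₚ.*-comm p q)
    (*-monoʳ-∣ p (p^∣-cancel j {d} p∤d (*-cancelˡ-∣ p (subst (p ℕ.* p ℕ.^ j ∣_) (trans (sym (ℕₚ.*-assoc d q p))
        (ℕₚ.*-comm (d ℕ.* q) p)) h))))
    where instance _ = prime⇒nonZero p-prime

  -- With x = N/D and d z = a - b, clearing denominators gives d N = p³ D (a - b). So p³ divides d
  -- N, hence N as p ∤ d; and D divides d N, hence d by coprimality, so p ∤ D.
  cube-divides : ∀ x {z} → Integral z → x ≡ ι p * ι p * (ι p * z) → (p ℕ.^ 3 ∣ ℤ.∣ ↥ x ∣) × p ∤ ↧ₙ x
  cube-divides x {z} (integral {d} {a} {b} p∤d e) x≡ =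
    p^∣-cancel 3 p∤d (divides-dM (n∣m*n D)) , λ p∣D → p∤d (∣-trans p∣D (coprime-divisor (Coprimality.sym coprime)
        (subst (D ∣_) (ℕₚ.*-comm d M) (divides-dM (m∣m*n (p ℕ.^ 3))))))
    where
    M D c : ℕ
    M = ℤ.∣ ↥ x ∣
    D = ↧ₙ x
    c = D ℕ.* (p ℕ.^ 3)
    coprime : Coprime M D
    coprime = lemma x
      where
      lemma : ∀ x → Coprime ℤ.∣ ↥ x ∣ (↧ₙ x)
      lemma (mkℚ n d-1 c) = Coprimality.recompute c
    ι-c : ι c ≡ ι D * (ι p * (ι p * ι p))
    ι-c = trans (ι-* D (p ℕ.^ 3)) (cong (ι D *_) (trans (ι-* p (p ℕ.* (p ℕ.* 1)))
        (cong (ι p *_) (trans (ι-* p (p ℕ.* 1)) (cong (λ m → ι p * ι m) (ℕₚ.*-identityʳ p))))))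
    ι-sum : ∀ k l m → ι (k ℕ.* l ℕ.+ c ℕ.* m) ≡ ι k * ι l + ι D * (ι p * (ι p * ι p)) * ι m
    ι-sum k l m = trans (ι-+ (k ℕ.* l) (c ℕ.* m)) (cong₂ _+_ (ι-* k l) (trans (ι-* c m) (cong (_* ι m) ι-c)))
    -- The cleared equation inside ℕ; the sign of the numerator decides on which side a and b stand.
    natural : d ℕ.* M ℕ.+ c ℕ.* b ≡ c ℕ.* a ⊎ d ℕ.* M ℕ.+ c ℕ.* a ≡ c ℕ.* b
    natural with ι-denominator x
    ... | inj₁ h = inj₁ (ι-injective (trans (ι-sum d M b)
        (trans (linear₃ (- ι d) (ι d * ι D) (ι D * (ι p * (ι p * ι p))) h x≡ e
      (solve 8 (λ d m D p a b x z → d :* m :+ D :* (p :* (p :* p)) :* b :- D :* (p :* (p :* p)) :* a :=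
         (:- d) :* (D :* x :- m) :+ d :* D :* (x :- p :* p :* (p :* z)) :+ D :* (p :* (p :* p)) :*
             (d :* z :+ b :- a)) refl (ι d) (ι M) (ι D) (ι p) (ι a) (ι b) x z))
      (sym (trans (ι-* c a) (cong (_* ι a) ι-c))))))
    ... | inj₂ h = inj₂ (ι-injective (trans (ι-sum d M a)
        (trans (linear₃ (ι d) (- (ι d * ι D)) (- (ι D * (ι p * (ι p * ι p)))) h x≡ e
      (solve 8 (λ d m D p a b x z → d :* m :+ D :* (p :* (p :* p)) :* a :- D :* (p :* (p :* p)) :* b :=
         d :* (D :* x :- :- m) :+ (:- (d :* D)) :* (x :- p :* p :* (p :* z)) :+ (:- (D :* (p :* (p :* p)))) :*
             (d :* z :+ b :- a)) refl (ι d) (ι M) (ι D) (ι p) (ι a) (ι b) x z))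
      (sym (trans (ι-* c b) (cong (_* ι b) ι-c))))))
    divides-dM : ∀ {y} → y ∣ c → y ∣ d ℕ.* M
    divides-dM {y} y∣c with natural
    ... | inj₁ h = ∣m+n∣m⇒∣n (subst (y ∣_) (trans (sym h) (ℕₚ.+-comm (d ℕ.* M) (c ℕ.* b))) (∣m⇒∣m*n a y∣c))
        (∣m⇒∣m*n b y∣c)
    ... | inj₂ h = ∣m+n∣m⇒∣n (subst (y ∣_) (trans (sym h) (ℕₚ.+-comm (d ℕ.* M) (c ℕ.* a))) (∣m⇒∣m*n b y∣c))
        (∣m⇒∣m*n a y∣c)

supercongruence : ∀ {p} r → p ≡ suc (dbl (suc (dbl r))) → Prime p →
  sumℚ p term8 ≡ - sumℚ p term-16 [mod p ^ 3 ]
supercongruence r refl p-prime = cube-divides p p-prime (sumℚ p term8 - - sumℚ p term-16) (_≈_.quot-integral W≈0)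
    (begin
  sumℚ p term8 - - sumℚ p term-16
    ≡⟨ solve 2 (λ a b → a :- :- b := a :+ b) refl (sumℚ p term8) (sumℚ p term-16) ⟩
  sumℚ p term8 + sumℚ p term-16
    ≡⟨ sum-+ p term8 term-16 ⟨
  sumℚ p (λ k → term8 k + term-16 k)
    ≡⟨ sum-ext p (λ k → trans (cong₂ _+_ (term8≡ k) (term-16≡ k)) (sym (*-distribˡ-+ (coef 0ℚ k) (pow2 k) (sgn k)))) ⟩
  sumℚ p (λ k → coef 0ℚ k * κ k)
    ≡⟨ trans sum-κ (cong (ι p * ι p *_) (trans (_≈_.equation W≈0) (+-identityˡ (ι p * _≈_.quot W≈0)))) ⟩
  ι p * ι p * (ι p * _≈_.quot W≈0) ∎)
  where open Residues r p-prime

dbl-dbl : ∀ r → dbl (dbl r) ≡ r ℕ.* 4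
dbl-dbl zero    = refl
dbl-dbl (suc r) = cong (4 ℕ.+_) (dbl-dbl r)

theorem1p1 : (p : ℕ) → Prime p → p % 4 ≡ 3 →
    sumℚ p term8 ≡ - sumℚ p term-16 [mod p ^ 3 ]
theorem1p1 p p-prime p%4≡3 = supercongruence (p ℕ./ 4) p≡4r+3 p-prime
  where
  p≡4r+3 : p ≡ suc (dbl (suc (dbl (p ℕ./ 4))))
  p≡4r+3 = trans (m≡m%n+[m/n]*n p 4) (trans (cong (ℕ._+ p ℕ./ 4 ℕ.* 4) p%4≡3)
      (cong (3 ℕ.+_) (sym (dbl-dbl (p ℕ./ 4)))))
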